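{- Let $H$ be a graph and let $v\in V(H)$ be a vertex that is not isolated. Then $H$ is a PCA graph if and only if $H\setminus\{v\}$ admits a round representation $\Phi$ that is $v$-receptive. Furthermore, for such a $\Phi$ and a receptive pair $(B_l,B_r)$ of $\Phi$ witnessing that $\Phi$ is $v$-receptive, the $\{v\}$-reception of $(B_l,B_r)$ in $\Phi$ is a round representation of $H$.
   Context: Orderings. A finite ordering $X=x_1,\dots,x_n$ is either linear or circular. Its right near neighbour map is $R(x_i)=x_{i+1}$ for $1\le i<n$, with $R(x_n)=x_1$ if $X$ is circular and $R(x_n)=\bot$ if linear; the left near neighbour map $L$ is symmetric ($L(x_{i+1})=x_i$, $L(x_1)=x_n$ if circular, $\bot$ if linear). Indices are taken modulo $n$; the range $[x_i,x_j]$ is the linear ordering $x_i,x_{i+1},\dots,x_j$, and $(x_i,x_j]$, $[x_i,x_j)$, $(x_i,x_j)$ are obtained by deleting the leftmost and/or rightmost element. $\bot$ is an undefined value with $f(\bot)=\bot$ for every map $f$ below. Contigs. A contig is a pair $\phi=(\mathcal B(\phi),F_r)$ where $\mathcal B(\phi)=B_1,\dots,B_n$ is a linear or circular ordering of pairwise disjoint nonempty sets (semiblocks) and $F_r:\mathcal B(\phi)\to\mathcal B(\phi)$ satisfies: (i) $F_r(B_i)\in(B_i,F_r(B_{i+1})]$ for $1\le i<n$; (ii) if $\mathcal B(\phi)$ is linear then $F_r(B_n)=B_n$, otherwise $F_r(B_n)\in[B_1,F_r(B_1)]$; (iii) $B_i\notin(F_r(B_i),F_r(F_r(B_i))]$ for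 all $i$. Write $B\to W$ when $W\in(B,F_r(B)]$. The left far neighbour $F_l(B)$ is the unique semiblock with: $W\to B$ iff $W\in[F_l(B),B)$. Round representations. A round representation $\Phi$ is a finite family of contigs with pairwise disjoint vertex sets such that either $|\Phi|=1$ or all its contigs are linear. $\mathcal B(\Phi)$ is the set of all semiblocks of its contigs and $V(\Phi)$ their union; $L,R,F_l,F_r$ act inside the contig containing the semiblock, and $B\to W$ requires $B,W$ to lie in the same contig. $B$ is a left (right) end semiblock if $L(B)=\bot$ ($R(B)=\bot$). The graph $G(\Phi)$ has vertex set $V(\Phi)$, with $x\in B$ and $y\in W$ adjacent iff $B=W$, $B\to W$ or $W\to B$. A graph is PCA if it is isomorphic to $G(\Phi)$ for some round representation $\Phi$; $\Phi$ then represents it. For semiblocks $B_1,B_2$ in different contigs $\phi_1,\phi_2$, the range $[B_1,B_2]$ is the range from $B_1$ to the right end semiblock of $\phi_1$ followed by the range from the left end semiblock of $\phi_2$ to $B_2$. Two semiblocks $B,W$ are indistinguishable if $F_l(B)=F_l(W)$ and $F_r(B)=F_r(W)$. Receptions. Let $\Psi$ be a round representation in which $\{v\}$ is a semiblock, and let $\Phi=\Psi\setminus\{\{v\}\}$ be the round representation obtained by deleting $\{v\}$ from the ordering of its contig (splitting it if necessary) such that $B\to_\Phi W$ iff $B\to_\Psi W$ for all remaining semiblocks. Let $B_l=F_l(\{v\})$ if $\{v\}$ is not a left end semiblock of $\Psi$ and $B_l=R(\{v\})$ otherwise; let $B_r=F_r(\{v\})$ if $\{v\}$ is not a right end semiblock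 and $B_r=L(\{v\})$ otherwise. Then $(B_l,B_r)$ is called a receptive pair of $\Phi$, and $\Psi$ is the $\{v\}$-reception of $(B_l,B_r)$ in $\Phi$. A round representation $\Phi$ of $H\setminus\{v\}$ is $v$-receptive if it has a receptive pair $(B_l,B_r)$ with $N_H(v)=\bigcup[B_l,B_r]$ and such that no two distinct semiblocks of $\mathcal B(\Phi)\setminus\{B_l,B_r\}$ are indistinguishable. -}

module Defs where

open import Data.Nat using (ℕ; zero; suc; _+_; _∸_; _≤_; _<_; _≤ᵇ_)
open import Data.Bool using (Bool; true; false; if_then_else_)
open import Data.Fin using (Fin; toℕ)
open import Data.Fin.Subset using (Subset; _∈_; _∉_; ⁅_⁆)
open import Data.Product using (Σ; ∃; _×_; _,_; proj₁; proj₂)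
open import Data.Sum using (_⊎_)
open import Relation.Nullary using (¬_)
open import Relation.Binary using (Decidable)
open import Relation.Binary.PropositionalEquality using (_≡_; _≢_)
open import Function.Bundles using (_⇔_)
open import Function.Definitions using (Injective)

record Graph (N : ℕ) : Set₁ where
  field
    Adj    : Fin N → Fin N → Set
    sym    : ∀ {x y} → Adj x y → Adj y x
    irrefl : ∀ {x} → ¬ Adj x x
    dec    : Decidable Adj

open Graph public

NonIsolated : ∀ {N} → Graph N → Fin N → Set
NonIsolated H v = ∃ λ u → Adj H v u

-- Raw round representations over the vertex universe Fin N.
-- A representation has m contigs; contig c is the ordering
-- B_0, ..., B_{size c - 1} of semiblocks  blk c i ⊆ Fin N,
-- circular iff  circ c ≡ true, with right far neighbour map  Fr c.

record Raw (N : ℕ) : Set where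
  field
    m    : ℕ
    size : Fin m → ℕ
    circ : Fin m → Bool
    blk  : (c : Fin m) → Fin (size c) → Subset N
    Fr   : (c : Fin m) → Fin (size c) → Fin (size c)

module _ {N : ℕ} (Φ : Raw N) where
  open Raw Φ

  Sb : Set
  Sb = Σ (Fin m) λ c → Fin (size c)

  Blk : Sb → Subset N
  Blk (c , i) = blk c i

  FrSb : Sb → Sb
  FrSb (c , i) = (c , Fr c i)

  SameC : Sb → Sb → Set
  SameC s t = proj₁ s ≡ proj₁ t

  offN : ℕ → ℕ → ℕ → ℕ
  offN n a b = if a ≤ᵇ b then b ∸ a else (n ∸ a) + b

  off : Sb → Sb → ℕ
  off a w = offN (size (proj₁ a)) (toℕ (proj₂ a)) (toℕ (proj₂ w))

  -- ranges inside one contig (indices modulo the contig size):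
  -- InCC a b w : w ∈ [a,b],  InOC a b w : w ∈ (a,b],  InCO a b w : w ∈ [a,b)
  InCC InOC InCO : Sb → Sb → Sb → Set
  InCC a b w = SameC a b × SameC a w × off a w ≤ off a b
  InOC a b w = SameC a b × SameC a w × 0 < off a w × off a w ≤ off a b
  InCO a b w = SameC a b × SameC a w × off a w < off a b

  Arrow : Sb → Sb → Set
  Arrow b w = InOC b (FrSb b) w

  IsFl : Sb → Sb → Set
  IsFl b f = SameC b f × (∀ w → Arrow w b ⇔ InCO f b w)

  -- near neighbours: RightOf s t  means  R(s) = t  (equivalently L(t) = s)
  RightOf : Sb → Sb → Set
  RightOf (c , i) (d , j) =
    c ≡ d × (suc (toℕ i) ≡ toℕ j ⊎ (circ c ≡ true × suc (toℕ i) ≡ size c × toℕ j ≡ 0))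

  LeftEnd RightEnd : Sb → Set
  LeftEnd  (c , i) = circ c ≡ false × toℕ i ≡ 0
  RightEnd (c , i) = circ c ≡ false × suc (toℕ i) ≡ size c

  Indist : Sb → Sb → Set
  Indist s t = (∃ λ f → IsFl s f × IsFl t f) × FrSb s ≡ FrSb t

  -- the range [bl, br] (also across two different linear contigs)
  InRange : Sb → Sb → Sb → Set
  InRange bl br w =
      (SameC bl br × InCC bl br w)
    ⊎ (¬ SameC bl br ×
        ((SameC bl w × toℕ (proj₂ bl) ≤ toℕ (proj₂ w))
         ⊎ (SameC br w × toℕ (proj₂ w) ≤ toℕ (proj₂ br))))

  InV : Fin N → Set
  InV x = ∃ λ s → x ∈ Blk s

  GAdj : Fin N → Fin N → Set
  GAdj x y = x ≢ y × ∃ λ s → ∃ λ t → x ∈ Blk s × y ∈ Blk t × (s ≡ t ⊎ Arrow s t ⊎ Arrow t s)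

  record IsRound : Set where
    field
      nonempty-contig : ∀ c → 1 ≤ size c
      nonempty-block  : ∀ s → ∃ λ x → x ∈ Blk s
      disjoint        : ∀ s t → s ≢ t → ∀ x → x ∈ Blk s → x ∉ Blk t
      one-or-linear   : m ≡ 1 ⊎ (∀ c → circ c ≡ false)
      cond-i   : ∀ c (i j : Fin (size c)) → suc (toℕ i) ≡ toℕ j →
                   InOC (c , i) (FrSb (c , j)) (FrSb (c , i))
      cond-ii-lin  : ∀ c (i : Fin (size c)) → suc (toℕ i) ≡ size c →
                   circ c ≡ false → Fr c i ≡ i
      cond-ii-circ : ∀ c (i f : Fin (size c)) → suc (toℕ i) ≡ size c →
                   circ c ≡ true → toℕ f ≡ 0 →
                   InCC (c , f) (FrSb (c , f)) (FrSb (c , i))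
      cond-iii : ∀ s → ¬ InOC (FrSb s) (FrSb (FrSb s)) s

RoundRep : ℕ → Set
RoundRep N = Σ (Raw N) IsRound

rw : ∀ {N} → RoundRep N → Raw N
rw = proj₁

RepresentsG : ∀ {N} → RoundRep N → Graph N → Set
RepresentsG Φ H = (∀ x → InV (rw Φ) x) × (∀ x y → GAdj (rw Φ) x y ⇔ Adj H x y)

RepresentsMinus : ∀ {N} → RoundRep N → Graph N → Fin N → Set
RepresentsMinus Φ H v =
  (∀ x → InV (rw Φ) x ⇔ (x ≢ v)) ×
  (∀ x y → x ≢ v → y ≢ v → GAdj (rw Φ) x y ⇔ Adj H x y)

PCA : ∀ {N} → Graph N → Set
PCA {N} H = ∃ λ (M : ℕ) → Σ (RoundRep M) λ Φ → Σ (Fin N → Fin M) λ f →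
  Injective _≡_ _≡_ f ×
  (∀ y → InV (rw Φ) y ⇔ (∃ λ x → f x ≡ y)) ×
  (∀ x y → Adj H x y ⇔ GAdj (rw Φ) (f x) (f y))

-- Φ = Ψ ∖ {{v}}, where sv is the semiblock {v} of Ψ.
-- Semiblocks of Φ and Ψ correspond via equality of their vertex sets.
module _ {N : ℕ} (Ψ : RoundRep N) (sv : Sb (rw Ψ)) (Φ : RoundRep N) where
  private
    P = rw Ψ
    F = rw Φ

  Corr : Sb F → Sb P → Set
  Corr s t = Blk F s ≡ Blk P t

  record Deleted : Set where
    field
      del-from : ∀ (s : Sb F) → ∃ λ t → Corr s t × t ≢ sv
      del-to   : ∀ (t : Sb P) → t ≢ sv → ∃ λ s → Corr s t
      arrows   : ∀ s s' t t' → Corr s t → Corr s' t' → Arrow F s s' ⇔ Arrow P t t'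
      -- the orderings are those of Ψ with {v} deleted, split exactly
      -- where the two neighbours of {v} are not adjacent
      order    : ∀ s s' t t' → Corr s t → Corr s' t' →
                   RightOf F s s' ⇔
                   (RightOf P t t' ⊎ (RightOf P t sv × RightOf P sv t' × Arrow P t t'))

IsReception : ∀ {N} (Φ : RoundRep N) (v : Fin N) (bl br : Sb (rw Φ)) → RoundRep N → Set
IsReception Φ v bl br Ψ =
  Σ (Sb (rw Ψ)) λ sv →
    Blk (rw Ψ) sv ≡ ⁅ v ⁆ ×
    Deleted Ψ sv Φ ×
    (∃ λ t → Blk (rw Ψ) t ≡ Blk (rw Φ) bl ×
       ((¬ LeftEnd (rw Ψ) sv × IsFl (rw Ψ) sv t) ⊎ (LeftEnd (rw Ψ) sv × RightOf (rw Ψ) sv t))) ×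
    (∃ λ t → Blk (rw Ψ) t ≡ Blk (rw Φ) br ×
       ((¬ RightEnd (rw Ψ) sv × t ≡ FrSb (rw Ψ) sv) ⊎ (RightEnd (rw Ψ) sv × RightOf (rw Ψ) t sv)))

ReceptivePair : ∀ {N} (Φ : RoundRep N) (v : Fin N) (bl br : Sb (rw Φ)) → Set
ReceptivePair Φ v bl br = ∃ λ Ψ → IsReception Φ v bl br Ψ

WitnessesReceptive : ∀ {N} (H : Graph N) (v : Fin N) (Φ : RoundRep N) (bl br : Sb (rw Φ)) → Set
WitnessesReceptive H v Φ bl br =
  ReceptivePair Φ v bl br ×
  (∀ x → Adj H v x ⇔ (∃ λ s → InRange (rw Φ) bl br s × x ∈ Blk (rw Φ) s)) ×
  (∀ s t → s ≢ t → s ≢ bl → s ≢ br → t ≢ bl → t ≢ br → ¬ Indist (rw Φ) s t)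

VReceptive : ∀ {N} (H : Graph N) (v : Fin N) (Φ : RoundRep N) → Set
VReceptive H v Φ = ∃ λ bl → ∃ λ br → WitnessesReceptive H v Φ bl br

{-# OPTIONS --safe #-}
module Submission where

-- A reception Ψ is determined near {v} by the block range [F_l(v), F_r(v)].  If v is an end block or
-- L(v) → R(v), walking to the right from any neighbour of v reaches B_r without passing B_l; otherwise
-- Φ is linear and the in- and out-neighbours of v are a final and an initial segment of its contigs.
-- Either way ⋃ [B_l, B_r] is the neighbourhood of v, so Ψ represents H.
--
-- Conversely, refine a representation of H to an orientation A of the edges along a circular order of
-- the vertices.  The order survives restriction, and R is recovered from A alone as its covering
-- relation, so restricting A to v and one vertex from each class of twins among the other vertices gives
-- Ψ, and dropping v gives Φ.  If two blocks x → y of Φ were indistinguishable, exactly one of them would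
-- be adjacent to v, since they are not twins in H; then B_r or B_l lies strictly between them and is a
-- twin of the one that is adjacent, a contradiction.

-- The blocks of a given representation of `H` are hard to work with directly: `{v}` need not be one
-- of them, and twins may occupy different, even nonconsecutive, blocks, so merging would mean
-- repairing all far neighbour maps. Choosing single vertices avoids this. What must survive the
-- choice is a condition on triples, `Spans`, which passes to sublists and is invariant under
-- rotation; a block is a clique, so ordering it by vertex number preserves the condition. Contigs
-- are cut out of a circular list by a dichotomy. If every element has an arrow to the next one all
-- the way round, there is one circular contig. A single missing arrow keeps every arrow from
-- passing that place, and all contigs become linear. In contigs obtained this way consecutive
-- elements are joined by an arrow; hence the covering relation, and hence deletion of `{v}` reduces
-- to comparing coverings with and without `v`. In the reception, the case distinction is whether
-- removing `{v}` opens a gap: then `[B_l, B_r]` no longer runs through the former place of `{v}`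
-- but over the outer ends of linear contigs.

open import Defs renaming (sym to Adj-sym; irrefl to Adj-irrefl; dec to Adj?)
open import Data.Nat using (ℕ; zero; suc; _+_; _∸_; _≤_; _<_; _≤ᵇ_; z≤n; s≤s; z<s)
open import Data.Nat.Properties
open import Data.Nat.Induction using (<-wellFounded)
open import Induction.WellFounded using (Acc; acc)
open import Level using (0ℓ)
open import Data.Bool as Bool using (Bool; true; false; if_then_else_)
open import Data.Fin as Fin using (Fin; toℕ; fromℕ<)
open import Data.Fin.Properties using (toℕ<n; toℕ-injective; toℕ-fromℕ<; toℕ-fromℕ; toℕ-inject₁; all?; any?)
open import Data.Fin.Subset using (Subset; _∈_; ⁅_⁆)
open import Data.Fin.Subset.Properties using (x∈⁅x⁆; x∈⁅y⁆⇒x≡y)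
open import Data.Vec using (tabulate)
open import Data.Vec.Properties using (lookup⇒[]=; []=⇒lookup; lookup∘tabulate)
open import Data.List using (List; []; _∷_; _++_; length; lookup; filter; initLast; _∷ʳ′_; [_]; allFin)
open import Data.List.Properties using (++-assoc; ++-identityʳ)
open import Data.List.Membership.Propositional using () renaming (_∈_ to _∈ˡ_)
open import Data.List.Membership.Propositional.Properties
  using (∈-lookup; ∈-++⁺ˡ; ∈-++⁺ʳ; ∈-++⁻; ∈-allFin; ∈-filter⁺; ∈-filter⁻)
open import Data.List.Relation.Unary.Any using (here; there; index)
open import Data.List.Relation.Unary.Any.Properties using (lookup-index)
open import Data.List.Relation.Unary.All as All using (All; []; _∷_)
import Data.List.Relation.Unary.All.Properties as Allₚ
open import Data.List.Relation.Unary.AllPairs as AllPairs using (AllPairs; []; _∷_)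
import Data.List.Relation.Unary.AllPairs.Properties as AllPairsₚ
open import Data.List.Relation.Unary.Linked using (Linked; []; [-]; _∷_)
open import Data.List.Relation.Unary.Unique.Propositional using (Unique)
open import Data.List.Relation.Unary.Unique.Propositional.Properties using (allFin⁺; filter⁺)
open import Data.List.Relation.Binary.Permutation.Propositional using (_↭_; ↭-sym; ↭⇒↭ₛ)
open import Data.List.Relation.Binary.Permutation.Propositional.Properties using (∈-resp-↭; ++-comm)
import Data.List.Relation.Binary.Permutation.Setoid.Properties as Permₛ
import Data.List.Relation.Unary.Sorted.TotalOrder.Properties as Sortedₚ
import Data.List.Sort as Sort
open import Data.Product using (Σ; ∃; _×_; _,_; proj₁; proj₂)
open import Data.Product.Properties using (≡-dec)
open import Data.Product.Relation.Binary.Lex.NonStrict using (×-decTotalOrder)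
open import Data.Sum using (_⊎_; inj₁; inj₂; swap)
open import Data.Unit using (⊤; tt)
open import Data.Empty using (⊥; ⊥-elim)
open import Function using (_∘_)
open import Function.Bundles using (_⇔_; mk⇔; Equivalence)
open import Relation.Nullary using (¬_; yes; no; Dec)
open import Relation.Nullary.Decidable using (_×-dec_; _⊎-dec_; _→-dec_; ¬?; does; dec-true)
open import Relation.Binary.Bundles using (DecTotalOrder)
open import Relation.Binary.Definitions using (tri<; tri≈; tri>)
import Relation.Binary.Construct.On as On
open import Relation.Binary.PropositionalEquality
  using (_≡_; _≢_; refl; sym; trans; cong; subst; subst₂; setoid)

open Equivalence using (to; from)

-- Offsets on a circle

-- Definitionally equal to offN Φ n a b for every Φ.
dist : ℕ → ℕ → ℕ → ℕ
dist n a b = if a ≤ᵇ b then b ∸ a else (n ∸ a) + b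

dist-≤ : ∀ n {a b} → a ≤ b → dist n a b ≡ b ∸ a
dist-≤ n {a} {b} p with a ≤ᵇ b | ≤⇒≤ᵇ p
... | true | _ = refl

dist-> : ∀ n {a b} → b < a → dist n a b ≡ (n ∸ a) + b
dist-> n {a} {b} p with a ≤ᵇ b in eq
... | true  = ⊥-elim (<⇒≱ p (≤ᵇ⇒≤ a b (subst Bool.T (sym eq) tt)))
... | false = refl

-- The congruence of `a + d` and `b` modulo `n` with at most one turn, as an equation without
-- subtraction. It determines offsets below `n`, and adding or splitting them becomes cancellation.
data Wraps (n a d b : ℕ) : Set where
  within : a + d ≡ b → Wraps n a d b
  across : a + d ≡ b + n → Wraps n a d b

module _ {n : ℕ} where

  dist-wraps : ∀ {a b} → a < n → Wraps n a (dist n a b) b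
  dist-wraps {a} {b} a<n with a ≤? b
  ... | yes p rewrite dist-≤ n p = within (m+[n∸m]≡n p)
  ... | no ¬p rewrite dist-> n (≰⇒> ¬p) = across (trans (sym (+-assoc a (n ∸ a) b))
          (trans (cong (_+ b) (m+[n∸m]≡n (<⇒≤ a<n))) (+-comm n b)))

  dist-< : ∀ {a b} → a < n → b < n → dist n a b < n
  dist-< {a} {b} a<n b<n with a ≤? b
  ... | yes p rewrite dist-≤ n p = ≤-<-trans (m∸n≤m b a) b<n
  ... | no ¬p rewrite dist-> n (≰⇒> ¬p) =
          subst (n ∸ a + b <_) (m∸n+n≡m (<⇒≤ a<n)) (+-monoʳ-< (n ∸ a) (≰⇒> ¬p))

  wraps-absurd : ∀ {a d e b} → e < n → a + d ≡ b → a + e ≡ b + n → d ≡ e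
  wraps-absurd {a} {d} {e} {b} e<n p q = ⊥-elim (<⇒≱ e<n (subst (n ≤_) (sym e≡) (m≤n+m n d)))
    where
    e≡ : e ≡ d + n
    e≡ = +-cancelˡ-≡ a _ _ (trans q (trans (cong (_+ n) (sym p)) (+-assoc a d n)))

  wraps-unique : ∀ {a d e b} → d < n → e < n → Wraps n a d b → Wraps n a e b → d ≡ e
  wraps-unique {a} _ _ (within p) (within q) = +-cancelˡ-≡ a _ _ (trans p (sym q))
  wraps-unique {a} _ _ (across p) (across q) = +-cancelˡ-≡ a _ _ (trans p (sym q))
  wraps-unique _ e<n (within p) (across q) = wraps-absurd e<n p q
  wraps-unique d<n _ (across p) (within q) = sym (wraps-absurd d<n q p)

  wraps-injective : ∀ {a d b c} → b < n → c < n → Wraps n a d b → Wraps n a d c → b ≡ c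
  wraps-injective _ _ (within p) (within q) = trans (sym p) q
  wraps-injective _ _ (across p) (across q) = +-cancelʳ-≡ n _ _ (trans (sym p) q)
  wraps-injective {b = b} {c} b<n _ (within p) (across q) =
    ⊥-elim (<⇒≱ b<n (subst (n ≤_) (trans (sym q) p) (m≤n+m n c)))
  wraps-injective {b = b} {c} _ c<n (across p) (within q) =
    ⊥-elim (<⇒≱ c<n (subst (n ≤_) (trans (sym p) q) (m≤n+m n b)))

  private
    swap-last : ∀ x y z → x + y + z ≡ x + z + y
    swap-last x y z = trans (+-assoc x y z) (trans (cong (x +_) (+-comm y z)) (sym (+-assoc x z y)))

  -- Of the four combinations only the double wrap has to be excluded: `a` and `d + e` are both
  -- below `n`, so their sum stays below two turns.
  wraps-add : ∀ {a d b e c} → a < n → d + e < n → Wraps n a d b → Wraps n b e c → Wraps n a (d + e) c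
  wraps-add {a} {d} {b} {e} _ _ (within p) (within q) =
    within (trans (sym (+-assoc a d e)) (trans (cong (_+ e) p) q))
  wraps-add {a} {d} {b} {e} _ _ (within p) (across q) =
    across (trans (sym (+-assoc a d e)) (trans (cong (_+ e) p) q))
  wraps-add {a} {d} {b} {e} _ _ (across p) (within q) =
    across (trans (sym (+-assoc a d e)) (trans (cong (_+ e) p) (trans (swap-last b n e) (cong (_+ n) q))))
  wraps-add {a} {d} {b} {e} {c} a<n de<n (across p) (across q) =
    ⊥-elim (<⇒≱ (+-mono-< a<n de<n) (subst (n + n ≤_) (sym eq) (+-monoˡ-≤ n (m≤n+m n c))))
    where
    eq : a + (d + e) ≡ c + n + n
    eq = trans (sym (+-assoc a d e)) (trans (cong (_+ e) p) (trans (swap-last b n e) (cong (_+ n) q)))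

  wraps-splitˡ : ∀ {a d b e c} → c < n → Wraps n a d b → Wraps n a (d + e) c → Wraps n b e c
  wraps-splitˡ {a} {d} {b} {e} _ (within p) (within q) = within (trans (cong (_+ e) (sym p)) (trans (+-assoc a d e) q))
  wraps-splitˡ {a} {d} {b} {e} _ (within p) (across q) = across (trans (cong (_+ e) (sym p)) (trans (+-assoc a d e) q))
  wraps-splitˡ {a} {d} {b} {e} {c} c<n (across p) (within q) =
    ⊥-elim (<⇒≱ c<n (subst (n ≤_) (sym c≡) (≤-trans (m≤n+m n b) (m≤m+n (b + n) e))))
    where
    c≡ : c ≡ b + n + e
    c≡ = trans (sym q) (trans (sym (+-assoc a d e)) (cong (_+ e) p))
  wraps-splitˡ {a} {d} {b} {e} {c} _ (across p) (across q) = within (+-cancelʳ-≡ n _ _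
    (trans (swap-last b e n) (trans (cong (_+ e) (sym p)) (trans (+-assoc a d e) q))))

  wraps-splitʳ : ∀ {a d b e c} → b < n → Wraps n b e c → Wraps n a (d + e) c → Wraps n a d b
  wraps-splitʳ {a} {d} {b} {e} _ (within p) (within q) =
    within (+-cancelʳ-≡ e _ _ (trans (+-assoc a d e) (trans q (sym p))))
  wraps-splitʳ {a} {d} {b} {e} _ (across p) (across q) =
    within (+-cancelʳ-≡ e _ _ (trans (+-assoc a d e) (trans q (sym p))))
  wraps-splitʳ {a} {d} {b} {e} _ (within p) (across q) =
    across (+-cancelʳ-≡ e _ _ (trans (+-assoc a d e) (trans q (trans (cong (_+ n) (sym p)) (swap-last b e n)))))
  wraps-splitʳ {a} {d} {b} {e} b<n (across p) (within q) =
    ⊥-elim (<⇒≱ b<n (subst (n ≤_) (sym b≡) (m≤n+m n (a + d))))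
    where
    b≡ : b ≡ a + d + n
    b≡ = +-cancelʳ-≡ e _ _ (trans p (trans (cong (_+ n) (trans (sym q) (sym (+-assoc a d e)))) (swap-last (a + d) e n)))

  wraps-flip : ∀ {a d b} → d ≤ n → Wraps n a d b → Wraps n b (n ∸ d) a
  wraps-flip {a} {d} {b} d≤n (within p) = across (trans (cong (_+ (n ∸ d)) (sym p))
    (trans (+-assoc a d _) (cong (a +_) (m+[n∸m]≡n d≤n))))
  wraps-flip {a} {d} {b} d≤n (across p) = within (+-cancelʳ-≡ d _ _ (trans (+-assoc b _ d)
    (trans (cong (b +_) (m∸n+n≡m d≤n)) (sym p))))

module _ {n : ℕ} where

  opaque
    -- Opaque, so that goals keep `δ` instead of its Boolean test. `δ-wraps` and `δ<n` determine it;
    -- `δ-dist` gives the formula back where indices have to be compared.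
    δ : Fin n → Fin n → ℕ
    δ i j = dist n (toℕ i) (toℕ j)

    δ-dist : ∀ i j → δ i j ≡ dist n (toℕ i) (toℕ j)
    δ-dist i j = refl

    δ-wraps : ∀ i j → Wraps n (toℕ i) (δ i j) (toℕ j)
    δ-wraps i j = dist-wraps (toℕ<n i)

    δ<n : ∀ i j → δ i j < n
    δ<n i j = dist-< (toℕ<n i) (toℕ<n j)

  δ-unique : ∀ {i j d} → d < n → Wraps n (toℕ i) d (toℕ j) → δ i j ≡ d
  δ-unique {i} {j} d<n w = wraps-unique (δ<n i j) d<n (δ-wraps i j) w

  δ-injective : ∀ {i j k} → δ i j ≡ δ i k → j ≡ k
  δ-injective {i} {j} {k} p = toℕ-injective (wraps-injective (toℕ<n j) (toℕ<n k) (δ-wraps i j)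
    (subst (λ d → Wraps n (toℕ i) d (toℕ k)) (sym p) (δ-wraps i k)))

  δ-refl : ∀ i → δ i i ≡ 0
  δ-refl i = δ-unique {i} {i} (≤-<-trans z≤n (toℕ<n i)) (within (+-identityʳ _))

  δ-zero : ∀ {i j} → δ i j ≡ 0 → i ≡ j
  δ-zero {i} {j} p = δ-injective {i} (trans (δ-refl i) (sym p))

  δ>0⇒≢ : ∀ {i j} → 0 < δ i j → i ≢ j
  δ>0⇒≢ {i} p refl = <⇒≢ p (sym (δ-refl i))

  ≢⇒δ>0 : ∀ {i j} → i ≢ j → 0 < δ i j
  ≢⇒δ>0 {i} {j} p = n≢0⇒n>0 (p ∘ δ-zero)

  δ-add : ∀ i j k → δ i j + δ j k < n → δ i k ≡ δ i j + δ j k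
  δ-add i j k p = δ-unique {i} {k} p (wraps-add (toℕ<n i) p (δ-wraps i j) (δ-wraps j k))

  δ-splitˡ : ∀ i j k → δ i j ≤ δ i k → δ i j + δ j k ≡ δ i k
  δ-splitˡ i j k p = trans (cong (δ i j +_) (δ-unique {j} {k} (≤-<-trans (m∸n≤m _ (δ i j)) (δ<n i k))
      (wraps-splitˡ (toℕ<n k) (δ-wraps i j)
        (subst (λ d → Wraps n (toℕ i) d (toℕ k)) (sym (m+[n∸m]≡n p)) (δ-wraps i k)))))
    (m+[n∸m]≡n p)

  δ-splitʳ : ∀ i j k → δ j k ≤ δ i k → δ i j + δ j k ≡ δ i k
  δ-splitʳ i j k p = trans (cong (_+ δ j k) (δ-unique {i} {j} (≤-<-trans (m∸n≤m _ (δ j k)) (δ<n i k))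
      (wraps-splitʳ (toℕ<n j) (δ-wraps j k)
        (subst (λ d → Wraps n (toℕ i) d (toℕ k)) (sym (m∸n+n≡m p)) (δ-wraps i k)))))
    (m∸n+n≡m p)

  δ-flip : ∀ {i j} → i ≢ j → δ i j + δ j i ≡ n
  δ-flip {i} {j} i≢j = trans (cong (δ i j +_) (δ-unique {j} {i}
      (∸-monoʳ-< (≢⇒δ>0 i≢j) (<⇒≤ (δ<n i j)))
      (wraps-flip (<⇒≤ (δ<n i j)) (δ-wraps i j))))
    (m+[n∸m]≡n (<⇒≤ (δ<n i j)))

  -- Cyclic successor, leading from the last index to the first even in a linear contig, since
  -- offsets are taken modulo the size in either case.
  Next : Fin n → Fin n → Set
  Next i j = suc (toℕ i) ≡ toℕ j ⊎ (suc (toℕ i) ≡ n × toℕ j ≡ 0)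

  next-wraps : ∀ {i j} → Next i j → Wraps n (toℕ i) 1 (toℕ j)
  next-wraps {i} (inj₁ p) = within (trans (+-comm (toℕ i) 1) p)
  next-wraps {i} {j} (inj₂ (p , q)) = across (trans (+-comm (toℕ i) 1) (trans p (cong (_+ n) (sym q))))

  δ-nextʳ : ∀ {i j} → Next i j → ∀ a → j ≢ a → δ a j ≡ suc (δ a i)
  δ-nextʳ {i} {j} s a j≢a with suc (δ a i) <? n
  ... | yes p = trans (δ-unique {a} {j} (subst (_< n) (+-comm 1 _) p)
                  (wraps-add (toℕ<n a) (subst (_< n) (+-comm 1 _) p) (δ-wraps a i) (next-wraps s)))
                  (+-comm _ 1)
  -- Here `i` has offset `n - 1` from `a`, so one more step arrives at `a`.
  ... | no ¬p = ⊥-elim (j≢a (toℕ-injective (wraps-injective {n = n} {a = toℕ i} {d = 1} (toℕ<n j) (toℕ<n a)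
                  (next-wraps s) (subst (λ d → Wraps n (toℕ i) d (toℕ a)) n∸d≡1
                    (wraps-flip {a = toℕ a} (<⇒≤ (δ<n a i)) (δ-wraps a i))))))
    where
    n∸d≡1 : n ∸ δ a i ≡ 1
    n∸d≡1 = trans (cong (_∸ δ a i) (≤-antisym (≮⇒≥ ¬p) (δ<n a i))) (m+n∸n≡m 1 (δ a i))

  δ-next : ∀ {i j} → Next i j → i ≢ j → δ i j ≡ 1
  δ-next {i} {j} s i≢j = trans (δ-nextʳ s i (i≢j ∘ sym)) (cong suc (δ-refl i))

  next-self : ∀ {i} → Next i i → ∀ j → i ≡ j
  next-self (inj₁ p) = ⊥-elim (1+n≢n p)
  next-self {i} (inj₂ (p , q)) j = toℕ-injective (trans q (sym (n<1⇒n≡0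
    (subst (toℕ j <_) (trans (sym p) (cong suc q)) (toℕ<n j)))))

  δ-nextˡ : ∀ {i j} → Next i j → ∀ b → i ≢ b → δ i b ≡ suc (δ j b)
  δ-nextˡ {i} {j} s b i≢b with i Fin.≟ j
  ... | yes refl = ⊥-elim (i≢b (next-self s b))
  ... | no i≢j = trans (sym (δ-splitˡ i j b (subst (_≤ δ i b) (sym (δ-next s i≢j)) (≢⇒δ>0 i≢b))))
                   (cong (_+ δ j b) (δ-next s i≢j))

  next-injectiveˡ : ∀ {i j k} → Next i k → Next j k → i ≡ j
  next-injectiveˡ (inj₁ p) (inj₁ q) = toℕ-injective (suc-injective (trans p (sym q)))
  next-injectiveˡ (inj₂ (p , _)) (inj₂ (q , _)) = toℕ-injective (suc-injective (trans p (sym q)))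
  next-injectiveˡ (inj₁ p) (inj₂ (_ , q)) = ⊥-elim (1+n≢0 (trans p q))
  next-injectiveˡ (inj₂ (_ , p)) (inj₁ q) = ⊥-elim (1+n≢0 (trans q p))

  next-injectiveʳ : ∀ {i j k} → Next i j → Next i k → j ≡ k
  next-injectiveʳ (inj₁ p) (inj₁ q) = toℕ-injective (trans (sym p) q)
  next-injectiveʳ (inj₂ (_ , p)) (inj₂ (_ , q)) = toℕ-injective (trans p (sym q))
  next-injectiveʳ {j = j} (inj₁ p) (inj₂ (q , _)) = ⊥-elim (<⇒≢ (toℕ<n j) (trans (sym p) q))
  next-injectiveʳ {k = k} (inj₂ (p , _)) (inj₁ q) = ⊥-elim (<⇒≢ (toℕ<n k) (trans (sym q) p))

  next : ∀ i → ∃ (Next i)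
  next i with suc (toℕ i) <? n
  ... | yes p = fromℕ< p , inj₁ (sym (toℕ-fromℕ< p))
  ... | no ¬p = fromℕ< 0<n , inj₂ (≤-antisym (toℕ<n i) (≮⇒≥ ¬p) , toℕ-fromℕ< 0<n)
    where 0<n = ≤-<-trans z≤n (toℕ<n i)

prev : ∀ {n} (j : Fin n) → ∃ λ i → Next i j
prev {suc n} Fin.zero = Fin.fromℕ n , inj₂ (cong suc (toℕ-fromℕ n) , refl)
prev {suc n} (Fin.suc j) = Fin.inject₁ j , inj₁ (cong suc (toℕ-inject₁ j))

fin-unique : ∀ {m} → m ≡ 1 → (c d : Fin m) → c ≡ d
fin-unique refl Fin.zero Fin.zero = refl

argmax : ∀ {n} {A : Fin n → Set} → (∀ i → Dec (A i)) → (h : Fin n → ℕ) →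
         (∃ λ i → A i × ∀ j → A j → h j ≤ h i) ⊎ (∀ i → ¬ A i)
argmax {zero} A? h = inj₂ λ ()
argmax {suc n} A? h with A? Fin.zero | argmax (A? ∘ Fin.suc) (h ∘ Fin.suc)
... | no ¬a | inj₂ none = inj₂ λ { Fin.zero → ¬a ; (Fin.suc j) → none j }
... | no ¬a | inj₁ (i , a , m) = inj₁ (Fin.suc i , a , λ { Fin.zero a₀ → ⊥-elim (¬a a₀) ; (Fin.suc j) → m j })
... | yes a₀ | inj₂ none = inj₁ (Fin.zero , a₀ , λ { Fin.zero _ → ≤-refl ; (Fin.suc j) a → ⊥-elim (none j a) })
... | yes a₀ | inj₁ (i , a , m) with ≤-total (h Fin.zero) (h (Fin.suc i))
... | inj₁ p = inj₁ (Fin.suc i , a , λ { Fin.zero _ → p ; (Fin.suc j) → m j })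
... | inj₂ p = inj₁ (Fin.zero , a₀ , λ { Fin.zero _ → ≤-refl ; (Fin.suc j) a′ → ≤-trans (m j a′) p })

-- Far neighbours inside a round representation

-- `F-mono` is conditions (i) and (ii) in terms of offsets, `F-proper` is condition (iii). `F-mono`
-- ranges over all cyclic successors: from the last block of a linear contig to the first it holds
-- because the last block has reach 0.
module Reach {n : ℕ} (F : Fin n → Fin n)
             (F-mono : ∀ i j → Next i j → δ i (F i) ≤ suc (δ j (F j)))
             (F-proper : ∀ i → 0 < δ (F i) i → ¬ (δ (F i) i ≤ δ (F i) (F (F i)))) where

  Arr : Fin n → Fin n → Set
  Arr i j = 0 < δ i j × δ i j ≤ δ i (F i)

  -- Telescopes `F-mono` along the `d` steps from `i` to `k`.
  reach-≤ : ∀ d i k → δ i k ≡ d → δ i (F i) ≤ d + δ k (F k)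
  reach-≤ zero i k p rewrite δ-zero {i = i} {j = k} p = ≤-refl
  reach-≤ (suc d) i k p = begin
      δ i (F i)              ≤⟨ reach-≤ d i k′ k′-dist ⟩
      d + δ k′ (F k′)        ≤⟨ +-monoʳ-≤ d (F-mono k′ k k′→k) ⟩
      d + suc (δ k (F k))    ≡⟨ +-suc d _ ⟩
      suc d + δ k (F k)      ∎
    where
    open ≤-Reasoning
    k′ = proj₁ (prev k)
    k′→k = proj₂ (prev k)
    k′-dist : δ i k′ ≡ d
    k′-dist = suc-injective (trans (sym (δ-nextʳ k′→k i
      λ { refl → 1+n≢0 (trans (sym p) (δ-refl i)) })) p)

  arr-suffix : ∀ {i k j} → Arr i j → δ i k < δ i j → Arr k j
  arr-suffix {i} {k} {j} (_ , le) lt = +-cancelˡ-< (δ i k) 0 (δ k j) (subst₂ _<_ (sym (+-identityʳ _)) (sym split) lt)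
      , +-cancelˡ-≤ (δ i k) _ _ (subst (_≤ δ i k + δ k (F k)) (sym split) (≤-trans le (reach-≤ _ i k refl)))
    where
    split = δ-splitˡ i k j (<⇒≤ lt)

  arr-prefix : ∀ {i k j} → Arr i j → 0 < δ i k → δ i k ≤ δ i j → Arr i k
  arr-prefix (_ , le) 0< lt = 0< , ≤-trans lt le

  -- If `i → j → i`, then `r = F i` lies at or after `j`, so by `reach-≤` it still reaches round to
  -- `i`; this is what condition (iii) forbids.
  arr-asym : ∀ {i j} → Arr i j → ¬ Arr j i
  arr-asym {i} {j} (0<ij , ij≤) (0<ji , ji≤) = F-proper i (≢⇒δ>0 r≢i) (+-cancelˡ-≤ (δ i r) _ _ (begin
      δ i r + δ r i                   ≡⟨ δ-flip (r≢i ∘ sym) ⟩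
      n                               ≡⟨ sym (δ-flip (δ>0⇒≢ 0<ij)) ⟩
      δ i j + δ j i                   ≤⟨ +-monoʳ-≤ (δ i j) ji≤ ⟩
      δ i j + δ j (F j)               ≤⟨ +-monoʳ-≤ (δ i j) (reach-≤ _ j r refl) ⟩
      δ i j + (δ j r + δ r (F r))     ≡⟨ sym (+-assoc (δ i j) _ _) ⟩
      δ i j + δ j r + δ r (F r)       ≡⟨ cong (_+ δ r (F r)) (δ-splitˡ i j r ij≤) ⟩
      δ i r + δ r (F r)               ∎))
    where
    open ≤-Reasoning
    r = F i
    r≢i : r ≢ i
    r≢i e = <⇒≱ 0<ij (subst (δ i j ≤_) (trans (cong (δ i) e) (δ-refl i)) ij≤)

  -- The last index `l` has reach 0, so by `reach-≤` nothing reaches past `l`, whereas an index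
  -- before `i` has a larger offset from `i` than `l` has.
  arr-linear : (∀ l → suc (toℕ l) ≡ n → F l ≡ l) → ∀ {i j} → Arr i j → toℕ i < toℕ j
  arr-linear fix {i} {j} (0<ij , ij≤) = ≰⇒> λ j≤i → <⇒≱ (beyond (≤∧≢⇒< j≤i (δ>0⇒≢ 0<ij ∘ sym ∘ toℕ-injective)))
      (≤-trans ij≤ (subst (δ i (F i) ≤_) (trans (cong (δ i l +_) gl≡0) (+-identityʳ _)) (reach-≤ _ i l refl)))
    where
    0<n = ≤-<-trans z≤n (toℕ<n i)
    l = proj₁ (prev (fromℕ< 0<n))
    suc-l : suc (toℕ l) ≡ n
    suc-l with proj₂ (prev (fromℕ< 0<n))
    ... | inj₁ p = ⊥-elim (1+n≢0 (trans p (toℕ-fromℕ< 0<n)))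
    ... | inj₂ (p , _) = p
    gl≡0 : δ l (F l) ≡ 0
    gl≡0 = trans (cong (δ l) (fix l suc-l)) (δ-refl l)
    i≤l : toℕ i ≤ toℕ l
    i≤l = ≤-pred (subst (toℕ i <_) (sym suc-l) (toℕ<n i))
    beyond : toℕ j < toℕ i → δ i l < δ i j
    beyond j<i = begin-strict
      δ i l                  ≡⟨ trans (δ-dist i l) (dist-≤ n i≤l) ⟩
      toℕ l ∸ toℕ i          <⟨ ∸-monoˡ-< (≤-reflexive suc-l) i≤l ⟩
      n ∸ toℕ i              ≤⟨ m≤m+n _ (toℕ j) ⟩
      n ∸ toℕ i + toℕ j      ≡⟨ sym (trans (δ-dist i j) (dist-> n j<i)) ⟩
      δ i j                  ∎
      where open ≤-Reasoning

  Arr? : ∀ i j → Dec (Arr i j)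
  Arr? i j = (0 <? δ i j) ×-dec (δ i j ≤? δ i (F i))

  -- The in-neighbour with the largest offset to `j`; with no in-neighbour it is `j` itself, which
  -- makes the range `[f, j)` empty.
  far-left : ∀ j → ∃ λ f → ∀ i → Arr i j ⇔ δ f i < δ f j
  far-left j with argmax (λ i → Arr? i j) (λ i → δ i j)
  ... | inj₂ none = j , λ i → mk⇔ (⊥-elim ∘ none i) λ lt → ⊥-elim (<⇒≱ lt (subst (_≤ δ j i) (sym (δ-refl j)) z≤n))
  ... | inj₁ (f , f→j , f-top) = f , λ i → mk⇔
          (λ a → subst (δ f i <_) (δ-splitʳ f i j (f-top i a)) (m<m+n (δ f i) (proj₁ a)))
          (arr-suffix f→j)

-- Arrows, near neighbours and far neighbours of the blocks of one representation

module Round {N : ℕ} (P : Raw N) (R : IsRound P) where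
  open Raw P
  open IsRound R

  off-δ : ∀ {c i j} → off P (c , i) (c , j) ≡ δ i j
  off-δ {c} {i} {j} = sym (δ-dist i j)

  -- A record, so that the type still determines `s` and `t`; `Arrow` itself unfolds to inequalities
  -- between offsets.
  record _⟶_ (s t : Sb P) : Set where
    constructor arrow
    field holds : Arrow P s t

  record _▸_ (s t : Sb P) : Set where
    constructor right
    field holds : RightOf P s t

  private
    mono : ∀ c (i j : Fin (size c)) → Next i j → δ i (Fr c i) ≤ suc (δ j (Fr c j))
    mono c i j (inj₁ p) with cond-i c i j p
    ... | _ , _ , 0< , le = ≤-trans le′ (≤-reflexive (δ-nextˡ (inj₁ p) (Fr c j)
            λ e → <⇒≱ 0<′ (≤-trans le′ (≤-reflexive (trans (cong (δ i) (sym e)) (δ-refl i))))))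
      where
      0<′ = subst (0 <_) off-δ 0<
      le′ = subst₂ _≤_ off-δ off-δ le
    mono c i j (inj₂ (p , q)) with i Fin.≟ Fr c i | circ c in circ-c
    ... | yes e | _ = ≤-trans (≤-reflexive (trans (cong (δ i) (sym e)) (δ-refl i))) z≤n
    ... | no ¬e | false = ⊥-elim (¬e (sym (cond-ii-lin c i p circ-c)))
    ... | no ¬e | true = ≤-trans (≤-reflexive (δ-nextˡ (inj₂ (p , q)) (Fr c i) ¬e))
            (s≤s (subst₂ _≤_ off-δ off-δ (proj₂ (proj₂ (cond-ii-circ c i j p circ-c q)))))

    module C (c : Fin m) = Reach (Fr c) (mono c)
      (λ i 0< le → cond-iii (c , i) (refl , refl , subst (0 <_) (sym off-δ) 0< , subst₂ _≤_ (sym off-δ) (sym off-δ) le))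

    arr⁺ : ∀ {c i j} → C.Arr c i j → (c , i) ⟶ (c , j)
    arr⁺ (0< , le) = arrow (refl , refl , subst (0 <_) (sym off-δ) 0< , subst₂ _≤_ (sym off-δ) (sym off-δ) le)

    arr⁻ : ∀ {c i j} → (c , i) ⟶ (c , j) → C.Arr c i j
    arr⁻ (arrow (_ , _ , 0< , le)) = subst (0 <_) off-δ 0< , subst₂ _≤_ off-δ off-δ le

  _≟ₛ_ : (s t : Sb P) → Dec (s ≡ t)
  _≟ₛ_ = ≡-dec Fin._≟_ Fin._≟_

  arrow-same : ∀ {s t} → s ⟶ t → SameC P s t
  arrow-same (arrow a) = proj₁ (proj₂ a)

  arrow-asym : ∀ {s t} → s ⟶ t → ¬ t ⟶ s
  arrow-asym {c , i} {_ , j} a@(arrow (_ , refl , _)) b = C.arr-asym c (arr⁻ a) (arr⁻ b)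

  arrow-irrefl : ∀ {s} → ¬ s ⟶ s
  arrow-irrefl a = arrow-asym a a

  arrow-linear : ∀ {s t} → circ (proj₁ s) ≡ false → s ⟶ t → toℕ (proj₂ s) < toℕ (proj₂ t)
  arrow-linear {c , i} {_ , j} lin a@(arrow (_ , refl , _)) = C.arr-linear c (λ l e → cond-ii-lin c l e lin) (arr⁻ a)

  rightOf-next : ∀ {c i j} → (c , i) ▸ (c , j) → Next i j
  rightOf-next (right (_ , inj₁ p)) = inj₁ p
  rightOf-next (right (_ , inj₂ (_ , p))) = inj₂ p

  rightOf-uniqueʳ : ∀ {s t t′} → s ▸ t → s ▸ t′ → t ≡ t′
  rightOf-uniqueʳ {c , i} r@(right (refl , _)) r′@(right (refl , _)) = cong (c ,_) (next-injectiveʳ (rightOf-next r) (rightOf-next r′))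

  rightOf-uniqueˡ : ∀ {s s′ t} → s ▸ t → s′ ▸ t → s ≡ s′
  rightOf-uniqueˡ {c , i} r@(right (refl , _)) r′@(right (refl , _)) = cong (c ,_) (next-injectiveˡ (rightOf-next r) (rightOf-next r′))

  arrow-step : ∀ {s v t} → s ⟶ v → s ▸ t → t ≢ v → t ⟶ v
  arrow-step {c , i} {_ , k} {_ , j} a@(arrow (_ , refl , _)) r@(right (refl , _)) t≢v =
    arr⁺ (C.arr-suffix c {i} {j} {k} (arr⁻ a)
      (subst (_< δ i k) (sym (δ-next nx i≢j)) (subst (1 <_) (sym (δ-nextˡ nx k i≢k)) (s≤s (≢⇒δ>0 (t≢v ∘ cong (c ,_)))))))
    where
    nx = rightOf-next r
    i≢k = δ>0⇒≢ (proj₁ (arr⁻ a))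
    i≢j : i ≢ j
    i≢j refl = i≢k (next-self nx k)

  arrow-between : ∀ {s t u} → s ⟶ u → SameC P s t → 0 < off P s t → off P s t < off P s u →
                  s ⟶ t × t ⟶ u
  arrow-between {c , i} {_ , j} {_ , k} a@(arrow (_ , refl , _)) refl 0< lt =
      arr⁺ (C.arr-prefix c {i} {j} {k} (arr⁻ a) (subst (0 <_) off-δ 0<) (<⇒≤ lt′)) ,
      arr⁺ (C.arr-suffix c {i} {j} {k} (arr⁻ a) lt′)
    where
    lt′ : δ i j < δ i k
    lt′ = subst₂ _<_ off-δ off-δ lt

  arrow-extend : ∀ {v s t} → v ⟶ s → s ≢ FrSb P v → s ▸ t → v ⟶ t
  arrow-extend {c , k} {_ , i} {_ , j} a@(arrow (_ , refl , _)) s≢ r@(right (refl , _)) =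
      arr⁺ (subst (0 <_) (sym eq) z<s , subst (_≤ δ k (Fr c k)) (sym eq) lt)
    where
    nx = rightOf-next r
    k≢i = δ>0⇒≢ (proj₁ (arr⁻ a))
    lt : suc (δ k i) ≤ δ k (Fr c k)
    lt = ≤∧≢⇒< (proj₂ (arr⁻ a)) (s≢ ∘ cong (c ,_) ∘ δ-injective)
    -- If the successor of `s` were `v`, the reach of `v` would be a full turn, while offsets stay
    -- below the size of the contig.
    j≢k : j ≢ k
    j≢k refl = <⇒≱ (δ<n k (Fr c k)) (subst (_≤ δ k (Fr c k)) n≡ lt)
      where
      n≡ : suc (δ k i) ≡ size c
      n≡ = trans (+-comm 1 _) (trans (cong (δ k i +_) (sym (δ-next nx (k≢i ∘ sym)))) (δ-flip k≢i))
    eq = δ-nextʳ nx k j≢k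

  arrow-retract : ∀ {v s t} → v ⟶ t → s ▸ t → s ≢ v → v ⟶ s
  arrow-retract {c , k} {_ , i} {_ , j} a@(arrow (_ , refl , _)) r@(right (refl , _)) s≢ =
    arr⁺ (≢⇒δ>0 (λ e → s≢ (cong (c ,_) (sym e))) ,
      ≤-trans (n≤1+n _) (≤-trans (≤-reflexive (sym (δ-nextʳ (rightOf-next r) k
        (λ e → δ>0⇒≢ (proj₁ (arr⁻ a)) (sym e))))) (proj₂ (arr⁻ a))))

  rightOf-arrow : ∀ {s t} → s ▸ t → FrSb P s ≢ s → s ⟶ t
  rightOf-arrow {c , i} {_ , j} r@(right (refl , _)) Fr≢ =
      arr⁺ (subst (0 <_) (sym (δ-next nx i≢j)) z<s ,
      subst (_≤ δ i (Fr c i)) (sym (δ-next nx i≢j)) (≢⇒δ>0 λ e → Fr≢ (cong (c ,_) (sym e))))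
    where
    nx = rightOf-next r
    i≢j : i ≢ j
    i≢j refl = Fr≢ (cong (c ,_) (sym (next-self nx (Fr c i))))

  Fr-arrow : ∀ {s} → FrSb P s ≢ s → s ⟶ (FrSb P s)
  Fr-arrow {c , i} Fr≢ = arr⁺ (≢⇒δ>0 (λ e → Fr≢ (cong (c ,_) (sym e))) , ≤-refl)

  arrow-before-Fr : ∀ {s t} → s ⟶ t → t ≢ FrSb P s → t ⟶ (FrSb P s)
  arrow-before-Fr {c , i} {_ , j} a@(arrow (_ , refl , _)) t≢ = arr⁺
    (C.arr-suffix c {i} {j} {Fr c i} (<-≤-trans (proj₁ (arr⁻ a)) (proj₂ (arr⁻ a)) , ≤-refl)
      (≤∧≢⇒< (proj₂ (arr⁻ a)) (t≢ ∘ cong (c ,_) ∘ δ-injective)))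

  ¬RightEnd⇒next : ∀ {s} → ¬ RightEnd P s → ∃ (s ▸_)
  ¬RightEnd⇒next {c , i} ¬e with next i | circ c in circ-c
  ... | j , inj₁ p | _ = (c , j) , right (refl , inj₁ p)
  ... | j , inj₂ p | true = (c , j) , right (refl , inj₂ (circ-c , p))
  ... | j , inj₂ (p , _) | false = ⊥-elim (¬e (refl , p))

  ¬LeftEnd⇒prev : ∀ {s} → ¬ LeftEnd P s → ∃ (_▸ s)
  ¬LeftEnd⇒prev {c , i} ¬e with prev i | circ c in circ-c
  ... | j , inj₁ p | _ = (c , j) , right (refl , inj₁ p)
  ... | j , inj₂ p | true = (c , j) , right (refl , inj₂ (circ-c , p))
  ... | j , inj₂ (_ , p) | false = ⊥-elim (¬e (refl , p))

  LeftEnd-source : ∀ {s t} → LeftEnd P s → ¬ t ⟶ s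
  LeftEnd-source {c , i} {_ , j} (lin , p) a@(arrow (_ , refl , _)) = n≮0 (subst (toℕ j <_) p (arrow-linear lin a))

  RightEnd-sink : ∀ {s t} → RightEnd P s → ¬ s ⟶ t
  RightEnd-sink {c , i} {_ , j} (lin , p) a@(arrow (_ , refl , _)) = <⇒≱ (toℕ<n j) (subst (_≤ toℕ j) p (arrow-linear lin a))

  arrow⇒next : ∀ {s t} → s ⟶ t → ∃ (s ▸_)
  arrow⇒next a = ¬RightEnd⇒next λ e → RightEnd-sink e a

  arrow⇒prev : ∀ {s t} → s ⟶ t → ∃ λ u → u ▸ t
  arrow⇒prev a = ¬LeftEnd⇒prev λ e → LeftEnd-source e a

  far-left : ∀ s → ∃ (IsFl P s)
  far-left (c , i) with C.far-left c i
  ... | f , eqv = (c , f) , refl , λ w → mk⇔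
          (λ { a@(_ , refl , _) → refl , refl , subst₂ _<_ (sym off-δ) (sym off-δ) (to (eqv _) (arr⁻ (arrow a))) })
          (λ { (_ , refl , lt) → _⟶_.holds (arr⁺ (from (eqv _) (subst₂ _<_ off-δ off-δ lt))) })

  Fl-arrow : ∀ {s f} → IsFl P s f → f ≢ s → f ⟶ s
  Fl-arrow {c , i} {_ , f} (refl , eqv) f≢ = arrow (from (eqv _)
    (refl , refl , subst₂ _<_ (sym (trans off-δ (δ-refl f))) (sym off-δ) (≢⇒δ>0 (f≢ ∘ cong (c ,_)))))

  Fl-retract : ∀ {v f s p} → IsFl P v f → s ⟶ v → s ≢ f → p ▸ s → p ⟶ v
  Fl-retract {c , k} {_ , f} {_ , i} {_ , j} (refl , eqv) (arrow a) s≢ r@(right (refl , _)) with to (eqv _) a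
  ... | _ , refl , lt = arrow (from (eqv _) (refl , refl , <-trans (≤-reflexive
          (sym (trans off-δ (trans (δ-nextʳ (rightOf-next r) f (s≢ ∘ cong (c ,_))) (cong suc (sym off-δ)))))) lt))

  -- If `f` came directly after `s`, the offset from `f` to `s` would be one less than a full turn,
  -- leaving no larger offset for `v`.
  Fl-not-next : ∀ {v f s t} → IsFl P v f → s ⟶ v → s ▸ t → t ≢ v → t ≢ f
  Fl-not-next {c , k} {_ , f} {_ , i} (refl , eqv) (arrow a) r@(right (refl , _)) t≢v refl with to (eqv _) a
  ... | _ , refl , lt = <⇒≱ (≤-<-trans (subst₂ _<_ off-δ off-δ lt) (δ<n f k)) (≤-reflexive (sym (trans (+-comm 1 _)
          (trans (cong (δ f i +_) (sym (δ-next nx i≢f))) (δ-flip (i≢f ∘ sym))))))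
    where
    nx = rightOf-next r
    i≢f : i ≢ f
    i≢f refl = t≢v (cong (c ,_) (next-self nx k))

  off-next : ∀ {s t} → s ▸ t → ∀ a → SameC P a s → t ≢ a → off P a t ≡ suc (off P a s)
  off-next {c , i} r@(right (refl , _)) (_ , k) refl t≢ =
    trans off-δ (trans (δ-nextʳ (rightOf-next r) k (t≢ ∘ cong (c ,_))) (cong suc (sym off-δ)))

  off-next′ : ∀ {s t} → s ▸ t → ∀ a → SameC P s a → s ≢ a → off P s a ≡ suc (off P t a)
  off-next′ {c , i} r@(right (refl , _)) (_ , k) refl s≢ =
    trans off-δ (trans (δ-nextˡ (rightOf-next r) k (s≢ ∘ cong (c ,_))) (cong suc (sym off-δ)))

  _⟶?_ : ∀ s t → Dec (s ⟶ t)
  (c , i) ⟶? (d , j) with c Fin.≟ d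
  ... | no c≢d = no (c≢d ∘ arrow-same)
  ... | yes refl with C.Arr? c i j
  ... | yes a = yes (arr⁺ a)
  ... | no ¬a = no (¬a ∘ arr⁻)

  idx : Sb P → ℕ
  idx s = toℕ (proj₂ s)

  rightOf-same : ∀ {s t} → s ▸ t → SameC P s t
  rightOf-same (right (e , _)) = e

  rightOf-self : ∀ {s u} → s ▸ s → SameC P s u → s ≡ u
  rightOf-self {c , i} {_ , k} r refl = cong (c ,_) (next-self (rightOf-next r) k)

  rightOf-linear : ∀ {s t} → circ (proj₁ s) ≡ false → s ▸ t → suc (idx s) ≡ idx t
  rightOf-linear lin (right (_ , inj₁ p)) = p
  rightOf-linear lin (right (_ , inj₂ (c , _))) with () ← trans (sym lin) c

  RightEnd-last : ∀ {s t} → RightEnd P s → ¬ (s ▸ t)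
  RightEnd-last {_} {_ , j} (lin , p) r@(right (refl , _)) = <⇒≢ (toℕ<n j) (trans (sym (rightOf-linear lin r)) p)

  LeftEnd-first : ∀ {s t} → LeftEnd P s → ¬ (t ▸ s)
  LeftEnd-first (lin , p) r@(right (refl , _)) = 1+n≢0 (trans (rightOf-linear lin r) p)

  LeftEnd? : ∀ s → Dec (LeftEnd P s)
  LeftEnd? (c , i) = (circ c Bool.≟ false) ×-dec (toℕ i ≟ 0)

  RightEnd? : ∀ s → Dec (RightEnd P s)
  RightEnd? (c , i) = (circ c Bool.≟ false) ×-dec (suc (toℕ i) ≟ size c)

  blk-injective : ∀ {s t} → Blk P s ≡ Blk P t → s ≡ t
  blk-injective {s} {t} e with s ≟ₛ t
  ... | yes p = p
  ... | no ¬p with nonempty-block s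
  ... | x , x∈ = ⊥-elim (disjoint s t ¬p x x∈ (subst (x ∈_) e x∈))

  block-unique : ∀ {x s t} → x ∈ Blk P s → x ∈ Blk P t → s ≡ t
  block-unique {x} {s} {t} x∈s x∈t with s ≟ₛ t
  ... | yes p = p
  ... | no ¬p = ⊥-elim (disjoint s t ¬p x x∈s x∈t)

  GAdj-sym : ∀ {x y} → GAdj P x y → GAdj P y x
  GAdj-sym (x≢y , s , t , x∈s , y∈t , inj₁ e) = x≢y ∘ sym , t , s , y∈t , x∈s , inj₁ (sym e)
  GAdj-sym (x≢y , s , t , x∈s , y∈t , inj₂ a) = x≢y ∘ sym , t , s , y∈t , x∈s , inj₂ (swap a)

  Fr-farthest : ∀ {s t} → s ⟶ t → s ⟶ FrSb P s × (t ≡ FrSb P s ⊎ t ⟶ FrSb P s)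
  Fr-farthest {c , i} {_ , j} a@(arrow (_ , refl , _)) with (c , j) ≟ₛ (c , Fr c i)
  ... | yes e = subst ((c , i) ⟶_) e a , inj₁ e
  ... | no ¬e = arr⁺ (<-≤-trans (proj₁ (arr⁻ a)) (proj₂ (arr⁻ a)) , ≤-refl) , inj₂ (arrow-before-Fr a ¬e)

  off≢0 : ∀ {s t} → SameC P s t → s ≢ t → 0 < off P s t
  off≢0 {c , i} refl s≢t = subst (0 <_) (sym off-δ) (≢⇒δ>0 (s≢t ∘ cong (c ,_)))

  off-self : ∀ s → off P s s ≡ 0
  off-self (c , i) = trans (off-δ {c}) (δ-refl i)

  Fl-farthest : ∀ {s f t} → IsFl P s f → t ⟶ s → f ⟶ s × (t ≡ f ⊎ f ⟶ t)
  Fl-farthest {s} {f} {t} fl (arrow a) with to (proj₂ fl t) a | t ≟ₛ f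
  ... | _ , same , lt | dec = f⟶s , farther dec
    where
    f⟶s : f ⟶ s
    f⟶s = Fl-arrow fl λ { refl → n≮0 (subst (off P f t <_) (off-self f) lt) }
    farther : Dec (t ≡ f) → t ≡ f ⊎ f ⟶ t
    farther (yes e) = inj₁ e
    farther (no ¬e) = inj₂ (proj₁ (arrow-between f⟶s same (off≢0 same (¬e ∘ sym)) lt))

  -- What indistinguishability yields in terms of arrows alone, so that it can be transferred to the
  -- orientation of the vertices.
  Dominated : Sb P → Sb P → Set
  Dominated s t = s ⟶ t × (∀ w → w ⟶ s → w ⟶ t) × (∀ w → t ⟶ w → s ⟶ w)

  private
    -- Being nearer to the common left far neighbour `f`, the block `s` lies in `[f, t)`, and
    -- `[f, s)` is part of `[f, t)`. For the out-neighbours, the common right far neighbour bounds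
    -- the offset from `s` through `t`, so adding offsets does not wrap.
    dominated : ∀ {s t f} → IsFl P s f → IsFl P t f → FrSb P s ≡ FrSb P t → off P f s < off P f t → Dominated s t
    dominated {s} {t} {f} (same , eq-s) (same′ , eq-t) Fr≡ lt = s⟶t , into , out s⟶t Fr≡
      where
      s⟶t : s ⟶ t
      s⟶t = arrow (from (eq-t s) (sym same′ , sym same , lt))
      into : ∀ w → w ⟶ s → w ⟶ t
      into w (arrow a) with to (eq-s w) a
      ... | _ , same″ , lt′ = arrow (from (eq-t w) (sym same′ , same″ , <-trans lt′ lt))
      out : ∀ {s t} → s ⟶ t → FrSb P s ≡ FrSb P t → ∀ w → t ⟶ w → s ⟶ w
      out {c , i} {_ , j} a@(arrow (_ , refl , _)) Fr≡ (_ , k) b@(arrow (_ , refl , _)) =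
          arr⁺ (subst (0 <_) (sym ik) (<-≤-trans (proj₁ (arr⁻ a)) (m≤m+n _ _)) , subst (_≤ δ i (Fr c i)) (sym ik) le)
        where
        le : δ i j + δ j k ≤ δ i (Fr c i)
        le = ≤-trans (+-monoʳ-≤ (δ i j) (proj₂ (arr⁻ b))) (≤-reflexive (trans
          (cong (λ r → δ i j + δ j r) (sym (Fr-injective Fr≡))) (δ-splitˡ i j (Fr c i) (proj₂ (arr⁻ a)))))
          where
          Fr-injective : ∀ {a b : Fin (size c)} → _≡_ {A = Sb P} (c , a) (c , b) → a ≡ b
          Fr-injective refl = refl
        ik : δ i k ≡ δ i j + δ j k
        ik = δ-add i j k (≤-<-trans le (δ<n i (Fr c i)))

  indist⇒dominated : ∀ {s t} → s ≢ t → Indist P s t → Dominated s t ⊎ Dominated t s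
  indist⇒dominated {s} {t} s≢t ((f , fl-s , fl-t) , Fr≡) with <-cmp (off P f s) (off P f t)
  ... | tri< lt _ _ = inj₁ (dominated {s} {t} {f} fl-s fl-t Fr≡ lt)
  ... | tri> _ _ gt = inj₂ (dominated {t} {s} {f} fl-t fl-s (sym Fr≡) gt)
  ... | tri≈ _ e _ = ⊥-elim (s≢t (off-injective f s t (sym (proj₁ fl-s)) (sym (proj₁ fl-t)) e))
    where
    off-injective : ∀ f s t → SameC P f s → SameC P f t → off P f s ≡ off P f t → s ≡ t
    off-injective (c , k) (_ , i) (_ , j) refl refl e = cong (c ,_) (δ-injective (trans (sym (off-δ {c} {k} {i})) (trans e (off-δ {c} {k} {j}))))

-- The blocks adjacent to v in a reception

module Reception {N : ℕ} (Φ Ψ : RoundRep N) (v : Fin N) (bl br : Sb (rw Φ))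
                 (reception : IsReception Φ v bl br Ψ) where

  private
    F = rw Φ
    P = rw Ψ
    module Φ = Round F (proj₂ Φ)
    module Ψ = Round P (proj₂ Ψ)
    open Φ using () renaming (_▸_ to _▸ᶠ_; _⟶_ to _⟶ᶠ_)
    open Ψ using (_▸_; _⟶_; arrow; right)
    deleted = proj₁ (proj₂ (proj₂ reception))
    open Deleted deleted

  sv : Sb P
  sv = proj₁ reception

  sv-block : Blk P sv ≡ ⁅ v ⁆
  sv-block = proj₁ (proj₂ reception)

  up : Sb F → Sb P
  up s = proj₁ (del-from s)

  up-block : ∀ s → Blk F s ≡ Blk P (up s)
  up-block s = proj₁ (proj₂ (del-from s))

  up≢sv : ∀ s → up s ≢ sv
  up≢sv s = proj₂ (proj₂ (del-from s))

  up-unique : ∀ {s t} → Blk F s ≡ Blk P t → up s ≡ t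
  up-unique {s} e = Ψ.blk-injective (trans (sym (up-block s)) e)

  up-injective : ∀ {s s′} → up s ≡ up s′ → s ≡ s′
  up-injective {s} {s′} e = Φ.blk-injective (trans (up-block s) (trans (cong (Blk P) e) (sym (up-block s′))))

  down : ∀ {t} → t ≢ sv → ∃ λ s → up s ≡ t
  down {t} t≢ with del-to t t≢
  ... | s , e = s , up-unique e

  up-arrow : ∀ {s s′} → Arrow F s s′ ⇔ Arrow P (up s) (up s′)
  up-arrow {s} {s′} = arrows s s′ _ _ (up-block s) (up-block s′)

  private
    via : ∀ {s s′} → up s ▸ sv → sv ▸ up s′ → up s ⟶ up s′ → s ▸ᶠ s′
    via {s} {s′} (right p) (right q) (arrow a) = Φ.right (from (order s s′ _ _ (up-block s) (up-block s′)) (inj₂ (p , q , a)))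

    direct : ∀ {s s′} → up s ▸ up s′ → s ▸ᶠ s′
    direct {s} {s′} (right p) = Φ.right (from (order s s′ _ _ (up-block s) (up-block s′)) (inj₁ p))

    order⁻ : ∀ {s s′} → s ▸ᶠ s′ → up s ▸ up s′ ⊎ (up s ▸ sv × sv ▸ up s′ × up s ⟶ up s′)
    order⁻ {s} {s′} (Φ.right r) with to (order s s′ _ _ (up-block s) (up-block s′)) r
    ... | inj₁ p = inj₁ (right p)
    ... | inj₂ (p , q , a) = inj₂ (right p , right q , arrow a)

    left-case : (¬ LeftEnd P sv × IsFl P sv (up bl)) ⊎ (LeftEnd P sv × sv ▸ up bl)
    left-case with proj₁ (proj₂ (proj₂ (proj₂ reception)))
    ... | t , e , c rewrite sym (up-unique (sym e)) with c
    ... | inj₁ p = inj₁ p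
    ... | inj₂ (p , r) = inj₂ (p , right r)

    right-case : (¬ RightEnd P sv × up br ≡ FrSb P sv) ⊎ (RightEnd P sv × up br ▸ sv)
    right-case with proj₂ (proj₂ (proj₂ (proj₂ reception)))
    ... | t , e , c rewrite sym (up-unique (sym e)) with c
    ... | inj₁ p = inj₁ p
    ... | inj₂ (p , r) = inj₂ (p , right r)

    Nb : Sb F → Set
    Nb s = up s ⟶ sv ⊎ sv ⟶ up s

    Nb-same : ∀ {s} → Nb s → SameC P (up s) sv
    Nb-same (inj₁ a) = Ψ.arrow-same a
    Nb-same (inj₂ a) = sym (Ψ.arrow-same a)

    isFl : ¬ LeftEnd P sv → IsFl P sv (up bl)
    isFl ¬e with left-case
    ... | inj₁ (_ , p) = p
    ... | inj₂ (e , _) = ⊥-elim (¬e e)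

    isFr : ¬ RightEnd P sv → up br ≡ FrSb P sv
    isFr ¬e with right-case
    ... | inj₁ (_ , p) = p
    ... | inj₂ (e , _) = ⊥-elim (¬e e)

    -- `B_r` is a block of `Φ` and hence not `{v}`; so the mere existence of the receptive pair says
    -- that `{v}` reaches something unless it is a right end.
    Fr≢sv : ¬ RightEnd P sv → FrSb P sv ≢ sv
    Fr≢sv ¬e e = up≢sv br (trans (isFr ¬e) e)

    bl⟶sv : ¬ LeftEnd P sv → up bl ⟶ sv
    bl⟶sv ¬e = Ψ.Fl-arrow (isFl ¬e) (up≢sv bl)

    sv⟶br : ¬ RightEnd P sv → sv ⟶ up br
    sv⟶br ¬e = subst (sv ⟶_) (sym (isFr ¬e)) (Ψ.Fr-arrow (Fr≢sv ¬e))

    sv⟶next : ∀ {t} → sv ▸ t → sv ⟶ t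
    sv⟶next r = Ψ.rightOf-arrow r (Fr≢sv λ e → Ψ.RightEnd-last e r)

    br-same : SameC P (up br) sv
    br-same with right-case
    ... | inj₁ (¬e , _) = sym (Ψ.arrow-same (sv⟶br ¬e))
    ... | inj₂ (_ , r) = Ψ.rightOf-same r

    Nb-bl : Nb bl
    Nb-bl with left-case
    ... | inj₁ (¬e , _) = inj₁ (bl⟶sv ¬e)
    ... | inj₂ (_ , r) = inj₂ (sv⟶next r)

    Joined : Set
    Joined = LeftEnd P sv ⊎ RightEnd P sv ⊎ (∃ λ l → ∃ λ r → l ▸ sv × sv ▸ r × l ⟶ r)

    Split : Set
    Split = ∃ λ l → ∃ λ r → l ▸ sv × sv ▸ r × ¬ (l ⟶ r)

    joined-or-split : Joined ⊎ Split
    joined-or-split with Ψ.LeftEnd? sv | Ψ.RightEnd? sv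
    ... | yes e | _ = inj₁ (inj₁ e)
    ... | no _ | yes e = inj₁ (inj₂ (inj₁ e))
    ... | no ¬e | no ¬e′ with Ψ.¬LeftEnd⇒prev ¬e | Ψ.¬RightEnd⇒next ¬e′
    ... | l , l▸sv | r , sv▸r with l Ψ.⟶? r
    ... | yes a = inj₁ (inj₂ (inj₂ (l , r , l▸sv , sv▸r , a)))
    ... | no ¬a = inj₂ (l , r , l▸sv , sv▸r , ¬a)

    to-br : Sb P → ℕ
    to-br t = off P t (up br)

    closer : ∀ {t t′} → t ▸ t′ → SameC P t sv → t ≢ up br → to-br t ≡ suc (to-br t′)
    closer r e = Ψ.off-next′ r (up br) (trans e (sym br-same))

    -- The only step of the walk that has to jump over `{v}`. At a left end there is nothing to jump
    -- from, and at a right end `L(v)` is `B_r`, where the walk stops.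
    joined-next : Joined → ∀ {s} → up s ▸ sv → s ≢ br → ∃ λ r → sv ▸ r × up s ⟶ r
    joined-next (inj₁ e) s▸sv _ = ⊥-elim (Ψ.LeftEnd-first e s▸sv)
    joined-next (inj₂ (inj₁ e)) s▸sv s≢br with right-case
    ... | inj₁ (¬e , _) = ⊥-elim (¬e e)
    ... | inj₂ (_ , r) = ⊥-elim (s≢br (up-injective (Ψ.rightOf-uniqueˡ s▸sv r)))
    joined-next (inj₂ (inj₂ (l , r , l▸sv , sv▸r , l⟶r))) s▸sv _ =
      r , sv▸r , subst (_⟶ r) (Ψ.rightOf-uniqueˡ l▸sv s▸sv) l⟶r

    -- The range when deleting `{v}` opens no gap

    module WhenJoined (joined : Joined) where

      -- The three clauses of the walk: along the in-neighbours, over `{v}`, along the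
      -- out-neighbours. The distance to `br` is measured in `Ψ`, where it falls by one in an
      -- ordinary step and by two in the jump.
      walk : ∀ s → Nb s → s ≢ br → ∃ λ s′ → s ▸ᶠ s′ × Nb s′ × s′ ≢ bl × to-br (up s′) < to-br (up s)
      walk s n@(inj₁ s⟶sv) s≢br with Ψ.arrow⇒next s⟶sv
      walk s n@(inj₁ s⟶sv) s≢br | q , s▸q with q Ψ.≟ₛ sv
      ... | no q≢sv with down q≢sv
      ... | s′ , refl = s′ , direct s▸q , inj₁ (Ψ.arrow-step s⟶sv s▸q q≢sv)
              , (λ e → Ψ.Fl-not-next (isFl λ e → Ψ.LeftEnd-source e s⟶sv) s⟶sv s▸q q≢sv (cong up e))
              , ≤-reflexive (sym (closer s▸q (Nb-same n) (s≢br ∘ up-injective)))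
      walk s n@(inj₁ s⟶sv) s≢br | _ , s▸sv | yes refl with joined-next joined s▸sv s≢br
      ... | r , sv▸r , s⟶r with down {r} (λ { refl → Ψ.arrow-irrefl (sv⟶next sv▸r) })
      ... | s′ , refl = s′ , via s▸sv sv▸r s⟶r , inj₂ (sv⟶next sv▸r)
              , (λ { refl → Ψ.arrow-asym (bl⟶sv λ e → Ψ.LeftEnd-first e s▸sv) (sv⟶next sv▸r) })
              , subst (to-br (up s′) <_) (sym (trans (closer s▸sv (Nb-same n) (s≢br ∘ up-injective))
                  (cong suc (closer sv▸r refl (up≢sv br ∘ sym))))) (m≤n⇒m≤1+n ≤-refl)
      walk s n@(inj₂ sv⟶s) s≢br with Ψ.arrow⇒next (Ψ.arrow-before-Fr sv⟶s s≢Fr)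
        where
        s≢Fr : up s ≢ FrSb P sv
        s≢Fr e = s≢br (up-injective (trans e (sym (isFr λ e → Ψ.RightEnd-sink e sv⟶s))))
      ... | q , s▸q with Ψ.arrow-extend sv⟶s (λ e → s≢br (up-injective (trans e (sym (isFr λ e → Ψ.RightEnd-sink e sv⟶s))))) s▸q
      ... | sv⟶q with down {q} (λ { refl → Ψ.arrow-irrefl sv⟶q })
      ... | s′ , refl = s′ , direct s▸q , inj₂ sv⟶q , s′≢bl , ≤-reflexive (sym (closer s▸q (Nb-same n) (s≢br ∘ up-injective)))
        where
        s′≢bl : s′ ≢ bl
        s′≢bl refl with left-case
        ... | inj₁ (¬e , _) = Ψ.arrow-asym (bl⟶sv ¬e) sv⟶q
        ... | inj₂ (_ , r) = up≢sv s (Ψ.rightOf-uniqueˡ s▸q r)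

      range-br : InRange F bl br br
      range-br with proj₁ bl Fin.≟ proj₁ br
      ... | yes e = inj₁ (e , e , e , ≤-refl)
      ... | no ¬e = inj₂ (¬e , inj₂ (refl , ≤-refl))

      -- Only a step back from `bl` can leave the range, which is why `walk` records that it never
      -- arrives at `bl`.
      range-retract : ∀ {s s′} → s ▸ᶠ s′ → s′ ≢ bl → InRange F bl br s′ → InRange F bl br s
      range-retract r s′≢bl (inj₁ (e , _ , e′ , le)) = inj₁ (e , e , trans e′ (sym (Φ.rightOf-same r)) ,
        ≤-trans (n≤1+n _) (≤-trans (≤-reflexive (sym (Φ.off-next r bl (trans e′ (sym (Φ.rightOf-same r))) s′≢bl))) le))
      range-retract {s} r s′≢bl (inj₂ (¬e , side)) with IsRound.one-or-linear (proj₂ Φ)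
      ... | inj₁ m≡1 = ⊥-elim (¬e (fin-unique m≡1 _ _))
      ... | inj₂ lin with Φ.rightOf-linear (lin (proj₁ s)) r | Φ.rightOf-same r | side
      ... | p | refl | inj₁ (refl , le) = inj₂ (¬e , inj₁ (refl ,
              ≤-pred (≤∧≢⇒< (≤-trans le (≤-reflexive (sym p))) λ q → s′≢bl (cong (_ ,_) (toℕ-injective (trans (sym p) (sym q)))))))
      ... | p | refl | inj₂ (refl , le) = inj₂ (¬e , inj₂ (refl , ≤-trans (≤-trans (n≤1+n _) (≤-reflexive p)) le))

      -- The last two components matter for `s = bl`: they put `bl` into the contig of `br`, and not
      -- behind `br` if that contig is linear. The converse inclusion starts from this.
      nb⇒range : ∀ s → Nb s → Acc _<_ (to-br (up s)) →
                 InRange F bl br s × SameC F s br × (Raw.circ F (proj₁ s) ≡ false → Φ.idx s ≤ Φ.idx br)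
      nb⇒range s n (acc rec) with s Φ.≟ₛ br
      ... | yes refl = range-br , refl , λ _ → ≤-refl
      ... | no s≢br with walk s n s≢br
      ... | s′ , r , n′ , s′≢bl , lt with nb⇒range s′ n′ (rec lt)
      ... | in-range , same , below = range-retract r s′≢bl in-range , trans (Φ.rightOf-same r) same ,
              λ lin → ≤-trans (≤-trans (n≤1+n _) (≤-reflexive (Φ.rightOf-linear lin r)))
                (below (subst (λ c → Raw.circ F c ≡ false) (Φ.rightOf-same r) lin))

      nb-step : ∀ {p s} → Nb p → p ≢ br → p ▸ᶠ s → Nb s
      nb-step {p} {s} n p≢br r with order⁻ r | n
      ... | inj₂ (_ , sv▸s , _) | _ = inj₂ (sv⟶next sv▸s)
      ... | inj₁ p▸s | inj₁ p⟶sv = inj₁ (Ψ.arrow-step p⟶sv p▸s (up≢sv s))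
      ... | inj₁ p▸s | inj₂ sv⟶p = inj₂ (Ψ.arrow-extend sv⟶p
              (λ e → p≢br (up-injective (trans e (sym (isFr λ e → Ψ.RightEnd-sink e sv⟶p))))) p▸s)

      private
        bl-facts = nb⇒range bl Nb-bl (<-wellFounded _)

      between⇒nb : ∀ d s → SameC F bl s → off F bl s ≤ off F bl br → off F bl s ≡ d → Nb s
      between⇒nb d s same le eq with s Φ.≟ₛ bl
      ... | yes refl = Nb-bl
      between⇒nb zero (c , i) refl le eq | no s≢bl = ⊥-elim (s≢bl (cong (c ,_) (sym (δ-zero (trans (sym (Φ.off-δ {c})) eq)))))
      between⇒nb (suc d) s same le eq | no s≢bl with Φ.¬LeftEnd⇒prev {s} ¬left
        where
        -- A left end other than `bl` precedes `bl`, so its offset from `bl` wraps and exceeds that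
        -- of `br`.
        ¬left : ¬ LeftEnd F s
        ¬left (lin , s≡0) = <⇒≱ (begin-strict
            off F bl br                                ≡⟨ dist-≤ n bl≤br ⟩
            Φ.idx br ∸ Φ.idx bl                        <⟨ ∸-monoˡ-< br<n bl≤br ⟩
            n ∸ Φ.idx bl                               ≤⟨ m≤m+n _ _ ⟩
            (n ∸ Φ.idx bl) + Φ.idx s                   ≡⟨ sym (dist-> n s<bl) ⟩
            off F bl s                                 ∎) le
          where
          open ≤-Reasoning
          n = Raw.size F (proj₁ bl)
          bl≤br = proj₂ (proj₂ bl-facts) (subst (λ c → Raw.circ F c ≡ false) (sym same) lin)
          br<n : Φ.idx br < n
          br<n = subst (λ c → Φ.idx br < Raw.size F c) (sym (proj₁ (proj₂ bl-facts))) (toℕ<n (proj₂ br))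
          s<bl : Φ.idx s < Φ.idx bl
          s<bl = ≰⇒> λ bl≤s → s≢bl (lemma same (trans s≡0 (sym (n≤0⇒n≡0 (subst (Φ.idx bl ≤_) s≡0 bl≤s)))))
            where
            lemma : ∀ {a b : Sb F} → SameC F a b → Φ.idx b ≡ Φ.idx a → b ≡ a
            lemma refl e = cong (_ ,_) (toℕ-injective e)
      ... | p , r with trans (sym (Φ.off-next r bl (trans same (sym (Φ.rightOf-same r))) s≢bl)) eq
      ... | e = nb-step (between⇒nb d p (trans same (sym (Φ.rightOf-same r))) (≤-trans (n≤1+n _) lt) (suc-injective e))
                  (λ { refl → 1+n≰n lt }) r
        where
        lt : suc (off F bl p) ≤ off F bl br
        lt = subst (_≤ off F bl br) (trans eq (sym e)) le

      range⇔nb : ∀ s → InRange F bl br s ⇔ Nb s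
      range⇔nb s = mk⇔
        (λ { (inj₁ (_ , _ , same , le)) → between⇒nb _ s same le refl
           ; (inj₂ (¬same , _)) → ⊥-elim (¬same (proj₁ (proj₂ bl-facts))) })
        (λ n → proj₁ (nb⇒range s n (<-wellFounded _)))

    -- The range when deleting `{v}` opens a gap

    module WhenSplit (l r : Sb P) (l▸sv : l ▸ sv) (sv▸r : sv ▸ r) (l↛r : ¬ (l ⟶ r)) where

      ¬left : ¬ LeftEnd P sv
      ¬left e = Ψ.LeftEnd-first e l▸sv

      ¬right : ¬ RightEnd P sv
      ¬right e = Ψ.RightEnd-last e sv▸r

      order-direct : ∀ {s s′} → s ▸ᶠ s′ → up s ▸ up s′
      order-direct r′ with order⁻ r′
      ... | inj₁ p = p
      ... | inj₂ (p , q , a) = ⊥-elim (l↛r (subst₂ _⟶_ (Ψ.rightOf-uniqueˡ p l▸sv) (Ψ.rightOf-uniqueʳ q sv▸r) a))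

      -- The left neighbour of {v} has no right neighbour in Φ, so no contig of Φ is circular.
      all-linear : ∀ c → Raw.circ F c ≡ false
      all-linear with down {l} (λ { refl → up≢sv bl (sym (Ψ.rightOf-self l▸sv (sym (Ψ.arrow-same (bl⟶sv ¬left))))) })
      ... | s , refl with Φ.RightEnd? s
      ... | no ¬e = ⊥-elim (dead (Φ.¬RightEnd⇒next ¬e))
        where
        dead : ¬ ∃ (s ▸ᶠ_)
        dead (s′ , r′) = up≢sv s′ (Ψ.rightOf-uniqueʳ (order-direct r′) l▸sv)
      ... | yes (lin , _) with IsRound.one-or-linear (proj₂ Φ)
      ... | inj₁ m≡1 = λ c → subst (λ d → Raw.circ F d ≡ false) (fin-unique m≡1 _ c) lin
      ... | inj₂ all = all

      idx-suc : ∀ {s s′} → s ▸ᶠ s′ → suc (Φ.idx s) ≡ Φ.idx s′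
      idx-suc = Φ.rightOf-linear (all-linear _)

      After : Sb F → Set
      After s = SameC F bl s × Φ.idx bl ≤ Φ.idx s

      Before : Sb F → Set
      Before s = SameC F br s × Φ.idx s ≤ Φ.idx br

      idx-injective : ∀ {a b : Sb F} → SameC F a b → Φ.idx a ≡ Φ.idx b → a ≡ b
      idx-injective refl e = cong (_ ,_) (toℕ-injective e)

      -- Walking back through in-neighbours of `{v}` ends at `bl`; no step touches `{v}`, so each is
      -- also a step of `Φ` and lowers the index by one.
      in⇒after : ∀ d s → up s ⟶ sv → off P (up bl) (up s) ≡ d → After s
      in⇒after d s s⟶sv eq with s Φ.≟ₛ bl
      ... | yes refl = refl , ≤-refl
      ... | no s≢bl with to (proj₂ (isFl ¬left) (up s)) (_⟶_.holds s⟶sv)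
      ... | _ , same , lt with Ψ.arrow⇒prev (proj₁ (Ψ.arrow-between {up bl} {up s} {sv} (bl⟶sv ¬left) same (off>0 _ _ same (s≢bl ∘ sym ∘ up-injective)) lt))
        where
        off>0 : ∀ a b → SameC P a b → a ≢ b → 0 < off P a b
        off>0 (c , i) (_ , j) refl a≢b = subst (0 <_) (sym (Ψ.off-δ {c})) (≢⇒δ>0 (a≢b ∘ cong (c ,_)))
      ... | p , p▸s with Ψ.Fl-retract (isFl ¬left) s⟶sv (s≢bl ∘ up-injective) p▸s
      ... | p⟶sv with down {p} (λ { refl → Ψ.arrow-irrefl p⟶sv }) | d
                    | trans (sym (Ψ.off-next p▸s (up bl) (trans same (sym (Ψ.rightOf-same p▸s))) (s≢bl ∘ up-injective))) eq
      ... | q , refl | suc d′ | e with in⇒after d′ q p⟶sv (suc-injective e) | direct p▸s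
      ... | same′ , le | r′ = trans same′ (Φ.rightOf-same r′) , ≤-trans le (≤-trans (n≤1+n _) (≤-reflexive (idx-suc r′)))

      after⇒in : ∀ d s → After s → Φ.idx s ≡ d → up s ⟶ sv
      after⇒in d s (same , le) eq with s Φ.≟ₛ bl
      ... | yes refl = bl⟶sv ¬left
      ... | no s≢bl with Φ.¬LeftEnd⇒prev {s} (λ { (_ , e) → s≢bl (sym (idx-injective same
                           (≤-antisym le (subst (_≤ Φ.idx bl) (sym e) z≤n)))) })
      ... | p , r′ with d | trans (idx-suc r′) eq
      ... | suc d′ | e = Ψ.arrow-step (after⇒in d′ p (trans same (sym (Φ.rightOf-same r′)) , le′) (suc-injective e))
                           (order-direct r′) (up≢sv s)
        where
        le′ : Φ.idx bl ≤ Φ.idx p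
        le′ = ≤-pred (≤-trans (≤∧≢⇒< le (s≢bl ∘ sym ∘ idx-injective same)) (≤-reflexive (sym (idx-suc r′))))

      out⇒before : ∀ d s → sv ⟶ up s → to-br (up s) ≡ d → Before s
      out⇒before d s sv⟶s eq with s Φ.≟ₛ br
      ... | yes refl = refl , ≤-refl
      ... | no s≢br with Ψ.arrow⇒next (Ψ.arrow-before-Fr sv⟶s λ e → s≢br (up-injective (trans e (sym (isFr ¬right)))))
      ... | q , s▸q with Ψ.arrow-extend sv⟶s (λ e → s≢br (up-injective (trans e (sym (isFr ¬right))))) s▸q
      ... | sv⟶q with down {q} (λ { refl → Ψ.arrow-irrefl sv⟶q }) | d
                    | trans (sym (closer s▸q (sym (Ψ.arrow-same sv⟶s)) (s≢br ∘ up-injective))) eq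
      ... | s′ , refl | suc d′ | e with out⇒before d′ s′ sv⟶q (suc-injective e) | direct s▸q
      ... | same , le | r′ = trans same (sym (Φ.rightOf-same r′)) , ≤-trans (≤-trans (n≤1+n _) (≤-reflexive (idx-suc r′))) le

      before⇒out : ∀ d s → Before s → Φ.idx s + d ≡ Φ.idx br → sv ⟶ up s
      before⇒out d s (same , le) eq with s Φ.≟ₛ br
      ... | yes refl = sv⟶br ¬right
      ... | no s≢br with Φ.¬RightEnd⇒next {s} (λ { (_ , e) → s≢br (sym (idx-injective same (≤-antisym
                           (≤-pred (subst (Φ.idx br <_) (trans (cong (Raw.size F) same) (sym e)) (toℕ<n (proj₂ br)))) le))) })
      ... | q , r′ with d | eq
      ... | zero | e = ⊥-elim (s≢br (sym (idx-injective same (trans (sym e) (+-identityʳ _)))))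
      ... | suc d′ | e = Ψ.arrow-retract (before⇒out d′ q (trans same (Φ.rightOf-same r′) , m+n≤o⇒m≤o _ (≤-reflexive e′)) e′)
                           (order-direct r′) (up≢sv s)
        where
        e′ : Φ.idx q + d′ ≡ Φ.idx br
        e′ = trans (cong (_+ d′) (sym (idx-suc r′))) (trans (sym (+-suc _ d′)) e)

      after-in : ∀ s → After s → up s ⟶ sv
      after-in s a = after⇒in _ s a refl

      before-out : ∀ s → Before s → sv ⟶ up s
      before-out s b = before⇒out _ s b (m+[n∸m]≡n (proj₂ b))

      -- When `bl` and `br` share a contig, `bl` cannot precede or equal `br`, since `br` would be
      -- an in- and an out-neighbour of `{v}` at once. So the modular range wraps, and it is again a
      -- final and an initial segment.
      range⇒sides : ∀ s → InRange F bl br s → After s ⊎ Before s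
      range⇒sides s (inj₂ (_ , inj₁ a)) = inj₁ a
      range⇒sides s (inj₂ (_ , inj₂ b)) = inj₂ b
      range⇒sides s (inj₁ (same , _ , same′ , le)) with Φ.idx bl ≤? Φ.idx s | Φ.idx bl ≤? Φ.idx br
      ... | yes p | _ = inj₁ (same′ , p)
      ... | no _ | yes q = ⊥-elim (Ψ.arrow-asym (after-in br (same , q)) (sv⟶br ¬right))
      ... | no p | no q = inj₂ (trans (sym same) same′ ,
              +-cancelˡ-≤ _ _ _ (subst₂ _≤_ (dist-> _ (≰⇒> p)) (dist-> _ (≰⇒> q)) le))

      sides⇒range : ∀ s → After s ⊎ Before s → InRange F bl br s
      sides⇒range s side with proj₁ bl Fin.≟ proj₁ br
      ... | no ¬same = inj₂ (¬same , side)
      ... | yes same with Φ.idx bl ≤? Φ.idx br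
      ... | yes q = ⊥-elim (Ψ.arrow-asym (after-in br (same , q)) (sv⟶br ¬right))
      ... | no q = inj₁ (same , same , side-same side , subst (off F bl s ≤_) (sym (dist-> n (≰⇒> q))) (side-≤ side))
        where
        n = Raw.size F (proj₁ bl)
        side-same : After s ⊎ Before s → SameC F bl s
        side-same (inj₁ (e , _)) = e
        side-same (inj₂ (e , _)) = trans same e
        side-≤ : After s ⊎ Before s → off F bl s ≤ (n ∸ Φ.idx bl) + Φ.idx br
        side-≤ (inj₁ (e , le)) = subst (_≤ n ∸ Φ.idx bl + Φ.idx br) (sym (dist-≤ n le))
          (≤-trans (∸-monoˡ-≤ (Φ.idx bl) (<⇒≤ (subst (λ c → Φ.idx s < Raw.size F c) (sym e) (toℕ<n (proj₂ s))))) (m≤m+n _ _))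
        side-≤ (inj₂ (_ , le)) = subst (_≤ n ∸ Φ.idx bl + Φ.idx br) (sym (dist-> n (≤-<-trans le (≰⇒> q)))) (+-monoʳ-≤ _ le)

      range⇔nb : ∀ s → InRange F bl br s ⇔ Nb s
      range⇔nb s = mk⇔ (λ i → fwd (range⇒sides s i)) (λ n → sides⇒range s (bwd n))
        where
        fwd : After s ⊎ Before s → Nb s
        fwd (inj₁ a) = inj₁ (after-in s a)
        fwd (inj₂ b) = inj₂ (before-out s b)
        bwd : Nb s → After s ⊎ Before s
        bwd (inj₁ a) = inj₁ (in⇒after _ s a refl)
        bwd (inj₂ a) = inj₂ (out⇒before _ s a refl)

  private
    unwrap : ∀ {s} → Nb s → Arrow P (up s) sv ⊎ Arrow P sv (up s)
    unwrap (inj₁ (arrow a)) = inj₁ a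
    unwrap (inj₂ (arrow a)) = inj₂ a
    wrap : ∀ {s} → Arrow P (up s) sv ⊎ Arrow P sv (up s) → Nb s
    wrap (inj₁ a) = inj₁ (arrow a)
    wrap (inj₂ a) = inj₂ (arrow a)

  range⇔neighbours : ∀ s → InRange F bl br s ⇔ (Arrow P (up s) sv ⊎ Arrow P sv (up s))
  range⇔neighbours s with joined-or-split
  ... | inj₁ j = mk⇔ (λ i → unwrap (to (WhenJoined.range⇔nb j s) i)) (λ n → from (WhenJoined.range⇔nb j s) (wrap n))
  ... | inj₂ (l , r , p , q , ¬a) =
    mk⇔ (λ i → unwrap (to (WhenSplit.range⇔nb l r p q ¬a s) i)) (λ n → from (WhenSplit.range⇔nb l r p q ¬a s) (wrap n))

  v∈sv : v ∈ Blk P sv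
  v∈sv = subst (v ∈_) (sym sv-block) (x∈⁅x⁆ v)

  ∈sv⇒v : ∀ {x} → x ∈ Blk P sv → x ≡ v
  ∈sv⇒v {x} p = x∈⁅y⁆⇒x≡y v (subst (x ∈_) sv-block p)

  ∈up : ∀ {x s} → x ∈ Blk F s → x ∈ Blk P (up s)
  ∈up {x} {s} = subst (x ∈_) (up-block s)

  ∉sv : ∀ {x t} → x ≢ v → x ∈ Blk P t → t ≢ sv
  ∉sv x≢v x∈ refl = x≢v (∈sv⇒v x∈)

  ∈down : ∀ {x t} → x ≢ v → x ∈ Blk P t → ∃ λ s → up s ≡ t × x ∈ Blk F s
  ∈down {x} x≢v x∈ with down (∉sv x≢v x∈)
  ... | s , refl = s , refl , subst (x ∈_) (sym (up-block s)) x∈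

  adjacent-v : ∀ x → GAdj P v x ⇔ (∃ λ s → InRange F bl br s × x ∈ Blk F s)
  adjacent-v x = mk⇔ fwd bwd
    where
    fwd : GAdj P v x → ∃ λ s → InRange F bl br s × x ∈ Blk F s
    fwd (v≢x , s , t , v∈s , x∈t , rel) with Ψ.block-unique v∈s v∈sv | ∈down (v≢x ∘ sym) x∈t | rel
    ... | refl | s′ , refl , x∈s′ | inj₁ e = ⊥-elim (up≢sv s′ (sym e))
    ... | refl | s′ , refl , x∈s′ | inj₂ a = s′ , from (range⇔neighbours s′) (swap a) , x∈s′
    bwd : (∃ λ s → InRange F bl br s × x ∈ Blk F s) → GAdj P v x
    bwd (s , i , x∈s) = (λ { refl → up≢sv s (Ψ.block-unique (∈up x∈s) v∈sv) }) ,
      sv , up s , v∈sv , ∈up x∈s , inj₂ (swap (to (range⇔neighbours s) i))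

  adjacent-rest : ∀ {x y} → x ≢ v → y ≢ v → GAdj F x y ⇔ GAdj P x y
  adjacent-rest {x} {y} x≢v y≢v = mk⇔ fwd bwd
    where
    fwd : GAdj F x y → GAdj P x y
    fwd (x≢y , s , t , x∈s , y∈t , inj₁ e) = x≢y , up s , up t , ∈up x∈s , ∈up y∈t , inj₁ (cong up e)
    fwd (x≢y , s , t , x∈s , y∈t , inj₂ (inj₁ a)) = x≢y , up s , up t , ∈up x∈s , ∈up y∈t , inj₂ (inj₁ (to up-arrow a))
    fwd (x≢y , s , t , x∈s , y∈t , inj₂ (inj₂ a)) = x≢y , up s , up t , ∈up x∈s , ∈up y∈t , inj₂ (inj₂ (to up-arrow a))
    bwd : GAdj P x y → GAdj F x y
    bwd (x≢y , s , t , x∈s , y∈t , rel) with ∈down x≢v x∈s | ∈down y≢v y∈t | rel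
    ... | s′ , refl , x∈ | t′ , refl , y∈ | inj₁ e = x≢y , s′ , t′ , x∈ , y∈ , inj₁ (up-injective e)
    ... | s′ , refl , x∈ | t′ , refl , y∈ | inj₂ (inj₁ a) = x≢y , s′ , t′ , x∈ , y∈ , inj₂ (inj₁ (from up-arrow a))
    ... | s′ , refl , x∈ | t′ , refl , y∈ | inj₂ (inj₂ a) = x≢y , s′ , t′ , x∈ , y∈ , inj₂ (inj₂ (from up-arrow a))

  represents : (H : Graph N) → RepresentsMinus Φ H v →
               (∀ x → Adj H v x ⇔ (∃ λ s → InRange F bl br s × x ∈ Blk F s)) → RepresentsG Ψ H
  represents H (vertices , adjacency) nbhd = covers , λ x y → mk⇔ (fwd x y) (bwd x y)
    where
    covers : ∀ x → InV P x
    covers x with x Fin.≟ v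
    ... | yes refl = sv , v∈sv
    ... | no x≢v with from (vertices x) x≢v
    ... | s , x∈s = up s , ∈up x∈s
    fwd : ∀ x y → GAdj P x y → Adj H x y
    fwd x y a with x Fin.≟ v | y Fin.≟ v
    ... | yes refl | _ = from (nbhd y) (to (adjacent-v y) a)
    ... | no _ | yes refl = Adj-sym H (from (nbhd x) (to (adjacent-v x) (Ψ.GAdj-sym a)))
    ... | no x≢v | no y≢v = to (adjacency x y x≢v y≢v) (from (adjacent-rest x≢v y≢v) a)
    bwd : ∀ x y → Adj H x y → GAdj P x y
    bwd x y a with x Fin.≟ v | y Fin.≟ v
    ... | yes refl | _ = from (adjacent-v y) (to (nbhd y) a)
    ... | no _ | yes refl = Ψ.GAdj-sym (from (adjacent-v x) (to (nbhd x) (Adj-sym H a)))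
    ... | no x≢v | no y≢v = to (adjacent-rest x≢v y≢v) (from (adjacency x y x≢v y≢v) a)

-- An arrow along the circular order x, y, z spans every element on its way.
Spans : {X : Set} → (X → X → Set) → X → X → X → Set
Spans A x y z = (A x z → A x y × A y z) × (A y x → A y z × A z x) × (A z y → A z x × A x y)

spans-rotate : {X : Set} {A : X → X → Set} {x y z : X} → Spans A x y z → Spans A y z x
spans-rotate (a , b , c) = b , c , a

-- Round representations from orientations

module Contig {n : ℕ} (A : Fin n → Fin n → Set) (A? : ∀ i j → Dec (A i j))
              (asym : ∀ {i j} → A i j → ¬ A j i)
              (spans : ∀ {i j k} → toℕ i < toℕ j → toℕ j < toℕ k → Spans A i j k) where

  -- Depending on which offsets wrap, some rotation of `i`, `j`, `k` is increasing. The offset to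
  -- `j` cannot wrap without the larger one to `k` wrapping too.
  cyclic-spans : ∀ {i j k} → 0 < δ i j → δ i j < δ i k → Spans A i j k
  cyclic-spans {i} {j} {k} 0<ij ij<ik with δ-wraps i j | δ-wraps i k
  ... | within p | within q = spans (subst (toℕ i <_) p (m<m+n _ 0<ij)) (subst₂ _<_ p q (+-monoʳ-< (toℕ i) ij<ik))
  ... | within p | across q = spans-rotate {A = A} {k} {i} {j} (spans (below q) (subst (toℕ i <_) p (m<m+n _ 0<ij)))
    where
    below : toℕ i + δ i k ≡ toℕ k + n → toℕ k < toℕ i
    below q = +-cancelʳ-< n _ _ (subst (_< toℕ i + n) q (+-monoʳ-< (toℕ i) (δ<n i k)))
  ... | across p | within q = ⊥-elim (<⇒≱ (toℕ<n k) (≤-trans (m≤n+m n (toℕ j))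
          (<⇒≤ (subst₂ _<_ p q (+-monoʳ-< (toℕ i) ij<ik)))))
  ... | across p | across q = spans-rotate {A = A} {k} {i} {j} (spans-rotate {A = A} {j} {k} {i} (spans
          (+-cancelʳ-< n _ _ (subst₂ _<_ p q (+-monoʳ-< (toℕ i) ij<ik)))
          (+-cancelʳ-< n _ _ (subst (_< toℕ i + n) q (+-monoʳ-< (toℕ i) (δ<n i k))))))

  irrefl : ∀ {i} → ¬ A i i
  irrefl a = asym a a

  arrow-δ>0 : ∀ {i j} → A i j → 0 < δ i j
  arrow-δ>0 a = ≢⇒δ>0 λ { refl → irrefl a }

  -- By `cyclic-spans` the out-neighbours form an interval directly after `i`, so the farthest one
  -- determines them all; `i` itself encodes the empty interval.
  far-right : ∀ i → ∃ λ r → ∀ j → A i j ⇔ (0 < δ i j × δ i j ≤ δ i r)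
  far-right i with argmax (A? i) (δ i)
  ... | inj₂ none = i , λ j → mk⇔ (⊥-elim ∘ none j) λ (0< , le) →
          ⊥-elim (<⇒≱ 0< (subst (δ i j ≤_) (δ-refl i) le))
  ... | inj₁ (r , a , top) = r , λ j → mk⇔ (λ a′ → arrow-δ>0 a′ , top j a′) λ (0< , le) → bwd j 0< le
    where
    bwd : ∀ j → 0 < δ i j → δ i j ≤ δ i r → A i j
    bwd j 0< le with j Fin.≟ r
    ... | yes refl = a
    ... | no j≢r = proj₁ (proj₁ (cyclic-spans 0< (≤∧≢⇒< le (j≢r ∘ δ-injective))) a)

  F : Fin n → Fin n
  F i = proj₁ (far-right i)

  arrow⇔ : ∀ {i j} → A i j ⇔ (0 < δ i j × δ i j ≤ δ i (F i))
  arrow⇔ {i} {j} = proj₂ (far-right i) j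

  arrow-F : ∀ {i} → 0 < δ i (F i) → A i (F i)
  arrow-F p = from arrow⇔ (p , ≤-refl)

  module _ {i j : Fin n} (nx : Next i j) (i→j : A i j) where

    F>0 : 0 < δ i (F i)
    F>0 = <-≤-trans (proj₁ (to arrow⇔ i→j)) (proj₂ (to arrow⇔ i→j))

    -- If `F i` is not `j`, the arrow to it passes over `j`. Measured from `j` this is condition
    -- (ii); `F-mono′` measures from `i`, as condition (i) does.
    F-mono : δ j (F i) ≤ δ j (F j)
    F-mono with F i Fin.≟ j
    ... | yes e = ≤-trans (≤-reflexive (trans (cong (δ j) e) (δ-refl j))) z≤n
    ... | no r≢j = proj₂ (to arrow⇔ (proj₂ (proj₁ (cyclic-spans (arrow-δ>0 i→j)
            (≤∧≢⇒< (proj₂ (to arrow⇔ i→j)) (r≢j ∘ sym ∘ δ-injective))) (arrow-F F>0))))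

    F-mono′ : δ i (F i) ≤ δ i (F j)
    F-mono′ = subst₂ _≤_ (sym (δ-nextˡ nx (F i) (δ>0⇒≢ F>0))) (sym (δ-nextˡ nx (F j) i≢Fj)) (s≤s F-mono)
      where
      i≢Fj : i ≢ F j
      i≢Fj e = asym i→j (subst (A j) (sym e) (arrow-F (≢⇒δ>0 λ e′ → irrefl (subst (λ x → A x j) (trans e (sym e′)) i→j))))

  F-proper : ∀ {i} → 0 < δ (F i) i → ¬ (δ (F i) i ≤ δ (F i) (F (F i)))
  F-proper 0< le = asym (arrow-F (≢⇒δ>0 λ e → δ>0⇒≢ 0< (sym e))) (from arrow⇔ (0< , le))

  -- A `k` with `i → k → j` would lie beyond the successor `j`, and then the arrow `i → k` contains
  -- `j → k`.
  covering : ∀ {i j} → Next i j → A i j → ∀ k → ¬ (A i k × A k j)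
  covering {i} {j} nx a k (b , c) = asym c (proj₂ (proj₁ (cyclic-spans (arrow-δ>0 a) ij<ik) b))
    where
    ij<ik : δ i j < δ i k
    ij<ik = ≤∧≢⇒< (subst (_≤ δ i k) (sym (δ-next nx λ { refl → irrefl a })) (arrow-δ>0 b))
              λ e → irrefl (subst (A k) (δ-injective e) c)

  -- An arrow that ends beyond the successor `q` passes over `q` and is therefore no covering.
  covering-next : ∀ {i j q} → Next i q → A i j → (∀ k → ¬ (A i k × A k j)) → j ≡ q
  covering-next {i} {j} {q} nx a cov with j Fin.≟ q
  ... | yes e = e
  ... | no j≢q = ⊥-elim (cov q (proj₁ (cyclic-spans (≢⇒δ>0 i≢q) (≤∧≢⇒< (subst (_≤ δ i j) (sym (δ-next nx i≢q)) (arrow-δ>0 a))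
          (j≢q ∘ sym ∘ δ-injective))) a))
    where
    i≢q : i ≢ q
    i≢q refl = irrefl (subst (A i) (sym (next-self nx j)) a)

-- Contigs as sequences of vertices, before far neighbours exist. One `circ` serves all of them, as
-- a representation is either a single contig or linear throughout. `consec` and `closed` are the
-- source of conditions (i) and (ii); `linear` and `apart` keep the arrows inside the linear
-- structure.
record Layout {N : ℕ} (A : Fin N → Fin N → Set) (S : Fin N → Set) : Set where
  field
    m        : ℕ
    size     : Fin m → ℕ
    circ     : Bool
    at       : (c : Fin m) → Fin (size c) → Fin N
    nonempty : ∀ c → 1 ≤ size c
    spans    : ∀ c {i j k} → toℕ i < toℕ j → toℕ j < toℕ k → Spans A (at c i) (at c j) (at c k)
    consec   : ∀ c {i j} → suc (toℕ i) ≡ toℕ j → A (at c i) (at c j)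
    closed   : circ ≡ true → m ≡ 1 × (∀ c {i j} → suc (toℕ i) ≡ size c → toℕ j ≡ 0 → A (at c i) (at c j))
    linear   : circ ≡ false → ∀ c {i j} → A (at c i) (at c j) → toℕ i < toℕ j
    apart    : ∀ {c d i j} → A (at c i) (at d j) → c ≡ d
    distinct : ∀ {c d i j} → at c i ≡ at d j → (c , i) ≡ (d , j)
    sound    : ∀ c i → S (at c i)
    complete : ∀ x → S x → ∃ λ c → ∃ λ i → at c i ≡ x

Covers : {X : Set} → (X → X → Set) → (X → Set) → X → X → Set
Covers A S x y = A x y × (∀ u → S u → ¬ (A x u × A u y))

-- All that is used later about a constructed representation: blocks, arrows and `R` expressed
-- through `A` and `S`. Two realisations of the same `A` can be compared without knowing how their
-- contigs were cut.
record Realises {N : ℕ} (Φ : RoundRep N) (A : Fin N → Fin N → Set) (S : Fin N → Set)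
                (cls : Fin N → Subset N) : Set where
  field
    rep      : Sb (rw Φ) → Fin N
    rep-inj  : ∀ {s t} → rep s ≡ rep t → s ≡ t
    sound    : ∀ s → S (rep s)
    complete : ∀ x → S x → ∃ λ s → rep s ≡ x
    block    : ∀ s → Blk (rw Φ) s ≡ cls (rep s)
    arrow    : ∀ s t → Arrow (rw Φ) s t ⇔ A (rep s) (rep t)
    rightOf  : ∀ s t → RightOf (rw Φ) s t ⇔ Covers A S (rep s) (rep t)

-- From a layout to a round representation

module Realise {N : ℕ} {A : Fin N → Fin N → Set} {S : Fin N → Set}
               (A? : ∀ x y → Dec (A x y)) (asym : ∀ {x y} → A x y → ¬ A y x)
               (L : Layout A S) (cls : Fin N → Subset N)
               (cls-nonempty : ∀ x → S x → ∃ λ u → u ∈ cls x)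
               (cls-disjoint : ∀ {x y u} → S x → S y → u ∈ cls x → u ∈ cls y → x ≡ y) where

  open Layout L
  module C (c : Fin m) = Contig (λ i j → A (at c i) (at c j)) (λ i j → A? _ _) asym (spans c)

  raw : Raw N
  raw = record { m = m ; size = size ; circ = λ _ → circ ; blk = λ c i → cls (at c i) ; Fr = λ c → C.F c }

  off-δ : ∀ c {i j} → off raw (c , i) (c , j) ≡ δ i j
  off-δ c {i} {j} = sym (δ-dist i j)

  isRound : IsRound raw
  isRound = record
    { nonempty-contig = nonempty
    ; nonempty-block  = λ (c , i) → cls-nonempty _ (sound c i)
    ; disjoint        = λ { (c , i) (d , j) s≢t x p q → s≢t (distinct (cls-disjoint (sound c i) (sound d j) p q)) }
    ; one-or-linear   = one-or-linear
    ; cond-i          = λ c i j e → refl , refl , subst (0 <_) (sym (off-δ c)) (C.F>0 c (inj₁ e) (consec c e)) ,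
                          subst₂ _≤_ (sym (off-δ c)) (sym (off-δ c)) (C.F-mono′ c (inj₁ e) (consec c e))
    ; cond-ii-lin     = λ c i e lin → fixed c i e lin
    ; cond-ii-circ    = λ c i f e cr z → refl , refl , subst₂ _≤_ (sym (off-δ c)) (sym (off-δ c))
                          (C.F-mono c (inj₂ (e , z)) (proj₂ (closed cr) c e z))
    ; cond-iii        = λ { (c , i) (_ , _ , 0< , le) → C.F-proper c (subst (0 <_) (off-δ c) 0<) (subst₂ _≤_ (off-δ c) (off-δ c) le) }
    }
    where
    one-or-linear : m ≡ 1 ⊎ (Fin m → circ ≡ false)
    one-or-linear with circ in e
    ... | true = inj₁ (proj₁ (closed e))
    ... | false = inj₂ λ _ → refl
    fixed : ∀ c i → suc (toℕ i) ≡ size c → circ ≡ false → C.F c i ≡ i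
    fixed c i e lin with C.F c i Fin.≟ i
    ... | yes p = p
    ... | no ¬p = ⊥-elim (<⇒≱ (linear lin c (C.arrow-F c (≢⇒δ>0 (¬p ∘ sym))))
                    (≤-pred (subst (toℕ (C.F c i) <_) (sym e) (toℕ<n _))))

  rep : Sb raw → Fin N
  rep (c , i) = at c i

  arrow⇔ : ∀ s t → Arrow raw s t ⇔ A (rep s) (rep t)
  arrow⇔ (c , i) (d , j) = mk⇔
    (λ { (_ , refl , 0< , le) → from (C.arrow⇔ c) (subst (0 <_) (off-δ c) 0< , subst₂ _≤_ (off-δ c) (off-δ c) le) })
    (λ a → bwd (apart a) a)
    where
    bwd : c ≡ d → A (at c i) (at d j) → Arrow raw (c , i) (d , j)
    bwd refl a with to (C.arrow⇔ c) a
    ... | 0< , le = refl , refl , subst (0 <_) (sym (off-δ c)) 0< , subst₂ _≤_ (sym (off-δ c)) (sym (off-δ c)) le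

  rightOf⇔ : ∀ s t → RightOf raw s t ⇔ Covers A S (rep s) (rep t)
  rightOf⇔ (c , i) (d , j) = mk⇔ fwd (λ cov → bwd (apart (proj₁ cov)) cov)
    where
    in-contig : ∀ {i j} → (∀ k → ¬ (A (at c i) (at c k) × A (at c k) (at c j))) →
                ∀ u → S u → ¬ (A (at c i) u × A u (at c j))
    in-contig none u u∈S (a , b) with complete u u∈S
    ... | e , k , refl with apart a
    ... | refl = none k (a , b)
    fwd : RightOf raw (c , i) (d , j) → Covers A S (at c i) (at d j)
    fwd (refl , inj₁ p) = consec c p , in-contig (C.covering c (inj₁ p) (consec c p))
    fwd (refl , inj₂ (cr , p , q)) = a , in-contig (C.covering c (inj₂ (p , q)) a)
      where a = proj₂ (closed cr) c p q
    bwd : c ≡ d → Covers A S (at c i) (at d j) → RightOf raw (c , i) (d , j)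
    bwd refl (a , none) with next i
    ... | q , nx with C.covering-next c nx a (λ k → none (at c k) (sound c k)) | nx
    ... | refl | inj₁ p = refl , inj₁ p
    ... | refl | inj₂ (p , z) with circ in e
    ... | true = refl , inj₂ (refl , p , z)
    -- The cyclic successor of the last index is index 0, and in a linear contig no arrow leads
    -- there.
    ... | false = ⊥-elim (n≮0 (subst (toℕ i <_) z (linear e c a)))

  realises : Realises (raw , isRound) A S cls
  realises = record
    { rep = rep ; rep-inj = distinct ; sound = λ (c , i) → sound c i
    ; complete = λ x x∈ → let c , i , e = complete x x∈ in (c , i) , e
    ; block = λ _ → refl ; arrow = arrow⇔ ; rightOf = rightOf⇔ }

-- Cutting a circular list into contigs

data Triples {X : Set} (R : X → X → X → Set) : List X → Set where
  []  : Triples R []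
  _∷_ : ∀ {x xs} → AllPairs (R x) xs → Triples R xs → Triples R (x ∷ xs)

module _ {X : Set} where

  allPairs-lookup : {R : X → X → Set} → ∀ {xs} → AllPairs R xs →
                    ∀ {i j} → toℕ i < toℕ j → R (lookup xs i) (lookup xs j)
  allPairs-lookup (r ∷ _) {Fin.zero} {Fin.suc j} _ = All.lookup r (∈-lookup j)
  allPairs-lookup (_ ∷ rs) {Fin.suc i} {Fin.suc j} (s≤s i<j) = allPairs-lookup rs i<j

  allPairs-++ˡ : {R : X → X → Set} → ∀ xs {ys} → AllPairs R (xs ++ ys) → AllPairs R xs
  allPairs-++ˡ [] _ = []
  allPairs-++ˡ (x ∷ xs) (r ∷ rs) = Allₚ.++⁻ˡ xs r ∷ allPairs-++ˡ xs rs

  allPairs-++ʳ : {R : X → X → Set} → ∀ xs {ys} → AllPairs R (xs ++ ys) → AllPairs R ys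
  allPairs-++ʳ [] rs = rs
  allPairs-++ʳ (x ∷ xs) (_ ∷ rs) = allPairs-++ʳ xs rs

  allPairs-++-cross : {R : X → X → Set} → ∀ {xs ys} → AllPairs R (xs ++ ys) →
                      ∀ {p q} → p ∈ˡ xs → q ∈ˡ ys → R p q
  allPairs-++-cross {xs = x ∷ xs} (r ∷ _) (here refl) q∈ = All.lookup (Allₚ.++⁻ʳ xs r) q∈
  allPairs-++-cross {xs = x ∷ xs} (_ ∷ rs) (there p∈) q∈ = allPairs-++-cross rs p∈ q∈

  module _ {R : X → X → X → Set} where

    triples-lookup : ∀ {xs} → Triples R xs → ∀ {i j k} → toℕ i < toℕ j → toℕ j < toℕ k →
                     R (lookup xs i) (lookup xs j) (lookup xs k)
    triples-lookup (r ∷ _) {Fin.zero} {Fin.suc j} {Fin.suc k} _ (s≤s j<k) = allPairs-lookup r j<k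
    triples-lookup (_ ∷ rs) {Fin.suc i} {Fin.suc j} {Fin.suc k} (s≤s i<j) (s≤s j<k) = triples-lookup rs i<j j<k

    triples-++ˡ : ∀ xs {ys} → Triples R (xs ++ ys) → Triples R xs
    triples-++ˡ [] _ = []
    triples-++ˡ (x ∷ xs) (r ∷ rs) = allPairs-++ˡ xs r ∷ triples-++ˡ xs rs

    triples-++ʳ : ∀ xs {ys} → Triples R (xs ++ ys) → Triples R ys
    triples-++ʳ [] rs = rs
    triples-++ʳ (x ∷ xs) (_ ∷ rs) = triples-++ʳ xs rs

    triples-filter : {S : X → Set} (S? : ∀ x → Dec (S x)) → ∀ {xs} → Triples R xs → Triples R (filter S? xs)
    triples-filter S? [] = []
    triples-filter S? {x ∷ xs} (r ∷ rs) with S? x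
    ... | yes _ = AllPairsₚ.filter⁺ S? r ∷ triples-filter S? rs
    ... | no _ = triples-filter S? rs

    triples-allPairs : ∀ {P : X → X → Set} → (∀ {x y z} → P x y → P x z → P y z → R x y z) →
                       ∀ {xs} → AllPairs P xs → Triples R xs
    triples-allPairs f [] = []
    triples-allPairs {P} f (p ∷ ps) = go p ps ∷ triples-allPairs f ps
      where
      go : ∀ {x xs} → All (P x) xs → AllPairs P xs → AllPairs (R x) xs
      go [] [] = []
      go (q ∷ qs) (r ∷ rs) = All.zipWith (λ (a , b) → f q a b) (qs , r) ∷ go qs rs

    module _ (rot : ∀ {x y z} → R x y z → R y z x) where

      triples-rotate₁ : ∀ {x} xs → Triples R (x ∷ xs) → Triples R (xs ++ [ x ])
      triples-rotate₁ [] t = t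
      triples-rotate₁ (y ∷ ys) ((r ∷ rs) ∷ (q ∷ qs)) =
        AllPairsₚ.++⁺ q ([] ∷ []) (All.map (λ a → rot a ∷ []) r) ∷ triples-rotate₁ ys (rs ∷ qs)

      triples-rotate : ∀ us {vs} → Triples R (us ++ vs) → Triples R (vs ++ us)
      triples-rotate [] {vs} t = subst (Triples R) (sym (++-identityʳ vs)) t
      triples-rotate (u ∷ us) {vs} t = subst (Triples R) (++-assoc vs [ u ] us)
        (triples-rotate us (subst (Triples R) (++-assoc us vs [ u ]) (triples-rotate₁ (us ++ vs) t)))

  linked-lookup : {R : X → X → Set} → ∀ {xs} → Linked R xs →
                  ∀ {i j} → suc (toℕ i) ≡ toℕ j → R (lookup xs i) (lookup xs j)
  linked-lookup (r ∷ _) {Fin.zero} {Fin.suc Fin.zero} _ = r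
  linked-lookup (_ ∷ rs) {Fin.suc i} {Fin.suc j} e = linked-lookup rs (suc-injective e)

  lookup-last : ∀ ws {a : X} (i : Fin (length (ws ++ [ a ]))) → suc (toℕ i) ≡ length (ws ++ [ a ]) →
                lookup (ws ++ [ a ]) i ≡ a
  lookup-last [] Fin.zero _ = refl
  lookup-last (w ∷ ws) {a} Fin.zero e = ⊥-elim (absurd ws (suc-injective e))
    where
    absurd : ∀ ws → 0 ≢ length (ws ++ [ a ])
    absurd [] ()
    absurd (_ ∷ _) ()
  lookup-last (w ∷ ws) (Fin.suc i) e = lookup-last ws i (suc-injective e)

  unique-lookup : ∀ {xs : List X} → Unique xs → ∀ {i j} → lookup xs i ≡ lookup xs j → i ≡ j
  unique-lookup u {i} {j} e with <-cmp (toℕ i) (toℕ j)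
  ... | tri< i<j _ _ = ⊥-elim (allPairs-lookup u i<j e)
  ... | tri≈ _ i≡j _ = toℕ-injective i≡j
  ... | tri> _ _ j<i = ⊥-elim (allPairs-lookup u j<i (sym e))

  Nonempties : Set
  Nonempties = List (X × List X)

  flat : Nonempties → List X
  flat [] = []
  flat ((x , t) ∷ r) = (x ∷ t) ++ flat r

  size : (r : Nonempties) → Fin (length r) → ℕ
  size r c = suc (length (proj₂ (lookup r c)))

  at : (r : Nonempties) (c : Fin (length r)) → Fin (size r c) → X
  at r c i = lookup (proj₁ (lookup r c) ∷ proj₂ (lookup r c)) i

  at∈flat : ∀ r c i → at r c i ∈ˡ flat r
  at∈flat ((x , t) ∷ r) Fin.zero i = ∈-++⁺ˡ (∈-lookup {xs = x ∷ t} i)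
  at∈flat ((x , t) ∷ r) (Fin.suc c) i = ∈-++⁺ʳ (x ∷ t) (at∈flat r c i)

  ∈flat⇒at : ∀ r {u} → u ∈ˡ flat r → ∃ λ c → ∃ λ i → at r c i ≡ u
  ∈flat⇒at ((x , t) ∷ r) u∈ with ∈-++⁻ (x ∷ t) u∈
  ... | inj₁ p = Fin.zero , index p , sym (lookup-index p)
  ... | inj₂ q with ∈flat⇒at r q
  ... | c , i , e = Fin.suc c , i , e

  flat-within : {R : X → X → Set} → ∀ r → AllPairs R (flat r) → ∀ c {i j} → toℕ i < toℕ j → R (at r c i) (at r c j)
  flat-within ((x , t) ∷ r) ps Fin.zero = allPairs-lookup (allPairs-++ˡ (x ∷ t) ps)
  flat-within ((x , t) ∷ r) ps (Fin.suc c) = flat-within r (allPairs-++ʳ (x ∷ t) ps) c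

  flat-across : {R : X → X → Set} → ∀ r → AllPairs R (flat r) → ∀ c d i j → toℕ c < toℕ d → R (at r c i) (at r d j)
  flat-across ((x , t) ∷ r) ps Fin.zero (Fin.suc d) i j _ =
    allPairs-++-cross ps (∈-lookup {xs = x ∷ t} i) (at∈flat r d j)
  flat-across ((x , t) ∷ r) ps (Fin.suc c) (Fin.suc d) i j (s≤s c<d) = flat-across r (allPairs-++ʳ (x ∷ t) ps) c d i j c<d

  flat-triples : {R : X → X → X → Set} → ∀ r → Triples R (flat r) → ∀ c {i j k} → toℕ i < toℕ j → toℕ j < toℕ k →
                 R (at r c i) (at r c j) (at r c k)
  flat-triples ((x , t) ∷ r) ts Fin.zero = triples-lookup (triples-++ˡ (x ∷ t) ts)
  flat-triples ((x , t) ∷ r) ts (Fin.suc c) = flat-triples r (triples-++ʳ (x ∷ t) ts) c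

module _ {X : Set} (A : X → X → Set) (A? : ∀ x y → Dec (A x y)) where

  -- Concerns arrows to later runs only; arrows to earlier runs are excluded by `Forward`.
  Separated : List (X × List X) → Set
  Separated [] = ⊤
  Separated ((x , t) ∷ r) = (∀ {p q} → p ∈ˡ x ∷ t → q ∈ˡ flat r → ¬ A p q) × Separated r

  separated-across : ∀ r → Separated r → ∀ c d i j → toℕ c < toℕ d → ¬ A (at r c i) (at r d j)
  separated-across ((x , t) ∷ r) (s , _) Fin.zero (Fin.suc d) i j _ = s (∈-lookup {xs = x ∷ t} i) (at∈flat r d j)
  separated-across ((x , t) ∷ r) (_ , s) (Fin.suc c) (Fin.suc d) i j (s≤s c<d) = separated-across r s c d i j c<d

  record Runs (xs : List X) : Set where
    field
      runs      : List (X × List X)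
      flat-runs : flat runs ≡ xs
      linked    : All (λ (x , t) → Linked A (x ∷ t)) runs
      separated : Separated runs

  -- Comparing `x` with the next element `y` is enough: by `Spans`, an arrow from `x` to a later `q`
  -- contains both `x → y` and `y → q`.
  maximal-runs : ∀ xs → Triples (Spans A) xs → Runs xs
  maximal-runs [] _ = record { runs = [] ; flat-runs = refl ; linked = [] ; separated = tt }
  maximal-runs (x ∷ []) _ =
    record { runs = (x , []) ∷ [] ; flat-runs = refl ; linked = [-] ∷ [] ; separated = (λ _ ()) , tt }
  maximal-runs (x ∷ y ∷ ys) ((s ∷ _) ∷ ts) with maximal-runs (y ∷ ys) ts
  ... | record { runs = (y , t) ∷ r ; flat-runs = refl ; linked = l ∷ ls ; separated = sep , seps } with A? x y
  ... | yes x→y = record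
    { runs = (x , y ∷ t) ∷ r ; flat-runs = refl ; linked = (x→y ∷ l) ∷ ls
    ; separated = (λ { (here refl) q∈ x→q → sep (here refl) q∈ (proj₂ (proj₁ (All.lookup s (∈-++⁺ʳ t q∈)) x→q))
                     ; (there p∈) q∈ → sep p∈ q∈ }) , seps }
  ... | no x↛y = record
    { runs = (x , []) ∷ (y , t) ∷ r ; flat-runs = refl ; linked = [-] ∷ l ∷ ls
    ; separated = (λ { (here refl) (here refl) → x↛y
                     ; (here refl) (there q∈) x→q → x↛y (proj₁ (proj₁ (All.lookup s q∈) x→q)) }) , sep , seps }

  Break : List X → Set
  Break xs = ∃ λ us → ∃ λ a → ∃ λ b → ∃ λ vs → xs ≡ us ++ a ∷ b ∷ vs × ¬ A a b

  linked-or-break : ∀ xs → Linked A xs ⊎ Break xs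
  linked-or-break [] = inj₁ []
  linked-or-break (x ∷ []) = inj₁ [-]
  linked-or-break (x ∷ y ∷ ys) with A? x y | linked-or-break (y ∷ ys)
  ... | no x↛y | _ = inj₂ ([] , x , y , ys , refl , x↛y)
  ... | yes x→y | inj₁ l = inj₁ (x→y ∷ l)
  ... | yes _ | inj₂ (us , a , b , vs , e , a↛b) = inj₂ (x ∷ us , a , b , vs , cong (x ∷_) e , a↛b)

  Forward : X → X → Set
  Forward p q = ¬ A q p

  -- A backward arrow would cross the seam between the last element `a` and the first element `b`;
  -- `Spans` then yields `a → b`, directly or by way of an arrow from `a` to an inner element.
  no-wrap⇒forward : ∀ b ws a → Triples (Spans A) (b ∷ ws ++ [ a ]) → ¬ A a b → AllPairs Forward (b ∷ ws ++ [ a ])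
  no-wrap⇒forward b ws a (s ∷ ts) a↛b = Allₚ.++⁺ (All.map (λ sp q→b → a↛b (proj₂ (proj₁ (proj₂ sp) q→b))) to-a) (a↛b ∷ [])
      ∷ AllPairsₚ.++⁺ (inner ws ts a↛) ([] ∷ []) (All.map (λ f → f ∷ []) a↛)
    where
    to-last : {R : X → X → Set} → ∀ ws → AllPairs R (ws ++ [ a ]) → All (λ p → R p a) ws
    to-last [] _ = []
    to-last (w ∷ ws) (r ∷ rs) = All.lookup r (∈-++⁺ʳ ws (here refl)) ∷ to-last ws rs
    to-a : All (λ p → Spans A b p a) ws
    to-a = to-last ws s
    a↛ : All (λ p → ¬ A a p) ws
    a↛ = All.map (λ sp a→p → a↛b (proj₁ (proj₂ (proj₂ sp) a→p))) to-a
    inner : ∀ ws → Triples (Spans A) (ws ++ [ a ]) → All (λ p → ¬ A a p) ws → AllPairs Forward ws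
    inner [] _ _ = []
    inner (w ∷ ws) (r ∷ rs) (w↛ ∷ f) = All.map (λ sp q→w → w↛ (proj₂ (proj₁ (proj₂ sp) q→w))) (to-last ws r) ∷ inner ws rs f

module _ {N : ℕ} {A : Fin N → Fin N → Set} (A? : ∀ x y → Dec (A x y)) (irrefl : ∀ {x} → ¬ A x x) where

  circular-layout : ∀ b ws a → Triples (Spans A) (b ∷ ws ++ [ a ]) → Unique (b ∷ ws ++ [ a ]) →
                    Linked A (b ∷ ws ++ [ a ]) → A a b → Layout A (_∈ˡ b ∷ ws ++ [ a ])
  circular-layout b ws a ts u l a→b = record
    { m = 1 ; size = λ _ → length xs ; circ = true ; at = λ _ → lookup xs
    ; nonempty = λ _ → s≤s z≤n
    ; spans = λ _ → triples-lookup ts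
    ; consec = λ _ → linked-lookup l
    ; closed = λ _ → refl , λ _ {i} {j} e z → subst₂ A (sym (lookup-last (b ∷ ws) i e)) (sym (lookup-zero j z)) a→b
    ; linear = λ ()
    ; apart = λ { {Fin.zero} {Fin.zero} _ → refl }
    ; distinct = λ { {Fin.zero} {Fin.zero} e → cong (Fin.zero ,_) (unique-lookup u e) }
    ; sound = λ _ i → ∈-lookup i
    ; complete = λ x x∈ → Fin.zero , index x∈ , sym (lookup-index x∈) }
    where
    xs = b ∷ ws ++ [ a ]
    lookup-zero : ∀ j → toℕ j ≡ 0 → lookup xs j ≡ b
    lookup-zero Fin.zero _ = refl

  linear-layout : ∀ xs → Triples (Spans A) xs → Unique xs → AllPairs (Forward A A?) xs → Layout A (_∈ˡ xs)
  linear-layout xs ts u fw with maximal-runs A A? xs ts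
  ... | record { runs = r ; flat-runs = refl ; linked = ls ; separated = sep } = record
    { m = length r ; size = size r ; circ = false ; at = at r
    ; nonempty = λ _ → s≤s z≤n
    ; spans = flat-triples r ts
    ; consec = λ c {i} {j} → linked-lookup (All.lookup ls (∈-lookup c)) {i} {j}
    ; closed = λ ()
    ; linear = λ _ c {i} {j} → linear c i j
    ; apart = λ {c} {d} {i} {j} → apart c d {i} {j}
    ; distinct = λ {c} {d} → distinct c d
    ; sound = at∈flat r
    ; complete = λ x → ∈flat⇒at r }
    where
    linear : ∀ c i j → A (at r c i) (at r c j) → toℕ i < toℕ j
    linear c i j a with <-cmp (toℕ i) (toℕ j)
    ... | tri< i<j _ _ = i<j
    ... | tri≈ _ i≡j _ = ⊥-elim (irrefl (subst (λ k → A (at r c i) (at r c k)) (sym (toℕ-injective i≡j)) a))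
    ... | tri> _ _ j<i = ⊥-elim (flat-within r fw c {j} {i} j<i a)
    apart : ∀ c d {i j} → A (at r c i) (at r d j) → c ≡ d
    apart c d {i} {j} a with <-cmp (toℕ c) (toℕ d)
    ... | tri< c<d _ _ = ⊥-elim (separated-across A A? r sep c d i j c<d a)
    ... | tri≈ _ c≡d _ = toℕ-injective c≡d
    ... | tri> _ _ d<c = ⊥-elim (flat-across r fw d c j i d<c a)
    distinct : ∀ c d {i j} → at r c i ≡ at r d j → (c , i) ≡ (d , j)
    distinct c d {i} {j} e with <-cmp (toℕ c) (toℕ d)
    ... | tri< c<d _ _ = ⊥-elim (flat-across r u c d i j c<d e)
    ... | tri> _ _ d<c = ⊥-elim (flat-across r u d c j i d<c (sym e))
    ... | tri≈ _ c≡d _ with refl ← toℕ-injective c≡d with <-cmp (toℕ i) (toℕ j)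
    ... | tri< i<j _ _ = ⊥-elim (flat-within r u c {i} {j} i<j e)
    ... | tri≈ _ i≡j _ = cong (c ,_) (toℕ-injective i≡j)
    ... | tri> _ _ j<i = ⊥-elim (flat-within r u c {j} {i} j<i (sym e))

  layout-⊆ : ∀ {S T : Fin N → Set} → (∀ {x} → S x → T x) → (∀ {x} → T x → S x) → Layout A S → Layout A T
  layout-⊆ f g L = record
    { Layout L using (m; size; circ; at; nonempty; spans; consec; closed; linear; apart; distinct)
    ; sound = λ c i → f (Layout.sound L c i) ; complete = λ x x∈ → Layout.complete L x (g x∈) }

  -- A missing arrow inside the list is rotated to the seam between last and first element, where
  -- `no-wrap⇒forward` applies. With no arrow missing inside, the seam itself decides between
  -- circular and linear.
  layout : ∀ xs → Triples (Spans A) xs → Unique xs → Layout A (_∈ˡ xs)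
  layout xs ts u with linked-or-break A A? xs
  layout xs ts u | inj₂ (us , a , b , vs , refl , a↛b) =
      layout-⊆ (∈-resp-↭ (↭-sym perm)) (∈-resp-↭ perm)
        (linear-layout zs zs-triples (Permₛ.Unique-resp-↭ (setoid _) (↭⇒↭ₛ perm) u)
          (subst (AllPairs (Forward A A?)) (sym zs≡) (no-wrap⇒forward A A? b (vs ++ us) a (subst (Triples (Spans A)) zs≡ zs-triples) a↛b)))
    where
    zs = (b ∷ vs) ++ (us ++ [ a ])
    zs≡ : zs ≡ b ∷ (vs ++ us) ++ [ a ]
    zs≡ = cong (b ∷_) (sym (++-assoc vs us [ a ]))
    xs≡ : us ++ a ∷ b ∷ vs ≡ (us ++ [ a ]) ++ b ∷ vs
    xs≡ = sym (++-assoc us [ a ] (b ∷ vs))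
    perm : us ++ a ∷ b ∷ vs ↭ zs
    perm = subst (_↭ zs) (sym xs≡) (++-comm (us ++ [ a ]) (b ∷ vs))
    zs-triples : Triples (Spans A) zs
    zs-triples = triples-rotate (λ {x} {y} {z} → spans-rotate {A = A} {x} {y} {z}) (us ++ [ a ]) (subst (Triples (Spans A)) xs≡ ts)
  layout [] ts u | inj₁ l = linear-layout [] ts u []
  layout (b ∷ xs) ts u | inj₁ l with initLast xs
  -- A single element has no arrow to itself, so it forms a linear contig.
  ... | [] = linear-layout (b ∷ []) ts u ([] ∷ [])
  ... | ws ∷ʳ′ a with A? a b
  ... | yes a→b = circular-layout b ws a ts u l a→b
  ... | no a↛b = linear-layout _ ts u (no-wrap⇒forward A A? b ws a ts a↛b)

-- The orientation of a PCA graph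

module Pointwise {M : ℕ} (Ψ : RoundRep M) where

  private
    P = rw Ψ
    module Ψ = Round P (proj₂ Ψ)
    open Ψ using (_⟶_; arrow)

  -- A block together with the number of a vertex in it. The number orders the vertices inside the
  -- block, turning that clique into a transitive tournament.
  Point : Set
  Point = Sb P × ℕ

  _⇢_ : Point → Point → Set
  (s , a) ⇢ (t , b) = s ⟶ t ⊎ (s ≡ t × a < b)

  _⇢?_ : ∀ p q → Dec (p ⇢ q)
  (s , a) ⇢? (t , b) = (s Ψ.⟶? t) ⊎-dec ((s Ψ.≟ₛ t) ×-dec (a <? b))

  ⇢-asym : ∀ p q → p ⇢ q → ¬ (q ⇢ p)
  ⇢-asym _ _ (inj₁ a) (inj₁ b) = Ψ.arrow-asym a b
  ⇢-asym _ _ (inj₁ a) (inj₂ (refl , _)) = Ψ.arrow-irrefl a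
  ⇢-asym _ _ (inj₂ (refl , _)) (inj₁ b) = Ψ.arrow-irrefl b
  ⇢-asym _ _ (inj₂ (_ , a)) (inj₂ (_ , b)) = <-asym a b

  _≺_ : Point → Point → Set
  ((c , i) , a) ≺ ((d , j) , b) =
    toℕ c < toℕ d ⊎ (toℕ c ≡ toℕ d × (toℕ i < toℕ j ⊎ (toℕ i ≡ toℕ j × a < b)))

  ≺-asym : ∀ p q → p ≺ q → ¬ (q ≺ p)
  ≺-asym _ _ (inj₁ p) (inj₁ q) = <-asym p q
  ≺-asym _ _ (inj₁ p) (inj₂ (e , _)) = <⇒≢ p (sym e)
  ≺-asym _ _ (inj₂ (e , _)) (inj₁ q) = <⇒≢ q (sym e)
  ≺-asym _ _ (inj₂ (_ , inj₁ p)) (inj₂ (_ , inj₁ q)) = <-asym p q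
  ≺-asym _ _ (inj₂ (_ , inj₁ p)) (inj₂ (_ , inj₂ (e , _))) = <⇒≢ p (sym e)
  ≺-asym _ _ (inj₂ (_ , inj₂ (e , _))) (inj₂ (_ , inj₁ q)) = <⇒≢ q (sym e)
  ≺-asym _ _ (inj₂ (_ , inj₂ (_ , p))) (inj₂ (_ , inj₂ (_ , q))) = <-asym p q

  module _ {c : Fin (Raw.m P)} where

    _◁_ : Fin (Raw.size P c) × ℕ → Fin (Raw.size P c) × ℕ → Set
    (i , a) ◁ (j , b) = toℕ i < toℕ j ⊎ (toℕ i ≡ toℕ j × a < b)

    ◁⇒≤ : ∀ p q → p ◁ q → toℕ (proj₁ p) ≤ toℕ (proj₁ q)
    ◁⇒≤ _ _ (inj₁ p) = <⇒≤ p
    ◁⇒≤ _ _ (inj₂ (e , _)) = ≤-reflexive e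

    ◁⇒< : ∀ {i a j b} → (i , a) ◁ (j , b) → i ≢ j → toℕ i < toℕ j
    ◁⇒< (inj₁ p) _ = p
    ◁⇒< (inj₂ (e , _)) i≢j = ⊥-elim (i≢j (toℕ-injective e))

    ◁⇒ids : ∀ {i a b} → (i , a) ◁ (i , b) → a < b
    ◁⇒ids (inj₁ p) = ⊥-elim (<-irrefl refl p)
    ◁⇒ids (inj₂ (_ , p)) = p

    Cyclic : Fin (Raw.size P c) × ℕ → Fin (Raw.size P c) × ℕ → Fin (Raw.size P c) × ℕ → Set
    Cyclic p q r = (p ◁ q × q ◁ r) ⊎ (q ◁ r × r ◁ p) ⊎ (r ◁ p × p ◁ q)

    private
      pt : Fin (Raw.size P c) × ℕ → Point
      pt (i , a) = (c , i) , a
      n = Raw.size P c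

    cyclic-δ : ∀ {i j k a b d} → i ≢ j → j ≢ k → i ≢ k → Cyclic (i , a) (j , b) (k , d) → δ i j < δ i k
    cyclic-δ {i} {j} {k} i≢j j≢k i≢k (inj₁ (p , q)) =
        subst₂ _<_ (sym (trans (δ-dist i j) (dist-≤ n (<⇒≤ i<j)))) (sym (trans (δ-dist i k) (dist-≤ n (<⇒≤ (<-trans i<j j<k)))))
          (∸-monoˡ-< j<k (<⇒≤ i<j))
      where
      i<j = ◁⇒< p i≢j
      j<k = ◁⇒< q j≢k
    cyclic-δ {i} {j} {k} i≢j j≢k i≢k (inj₂ (inj₁ (p , q))) =
        subst₂ _<_ (sym (trans (δ-dist i j) (dist-> n (<-trans j<k k<i)))) (sym (trans (δ-dist i k) (dist-> n k<i)))
          (+-monoʳ-< (n ∸ toℕ i) j<k)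
      where
      j<k = ◁⇒< p j≢k
      k<i = ◁⇒< q (i≢k ∘ sym)
    cyclic-δ {i} {j} {k} i≢j j≢k i≢k (inj₂ (inj₂ (p , q))) =
        subst₂ _<_ (sym (trans (δ-dist i j) (dist-≤ n (<⇒≤ i<j)))) (sym (trans (δ-dist i k) (dist-> n k<i)))
          (<-≤-trans (∸-monoˡ-< (toℕ<n j) (<⇒≤ i<j)) (m≤m+n _ (toℕ k)))
      where
      k<i = ◁⇒< p (i≢k ∘ sym)
      i<j = ◁⇒< q i≢j

    -- For three distinct blocks this is `arrow-between`. If the middle point shares a block with an
    -- end, the cyclic order puts their numbers the right way round; if both ends share a block, the
    -- middle point is forced into it.
    cyclic-spans : ∀ p q r → Cyclic p q r → pt p ⇢ pt r → pt p ⇢ pt q × pt q ⇢ pt r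
    cyclic-spans (i , _) (j , _) (k , _) cyc (inj₁ a) with i Fin.≟ j | j Fin.≟ k
    ... | yes refl | yes refl = ⊥-elim (Ψ.arrow-irrefl a)
    ... | yes refl | no i≢k = inj₂ (refl , ids cyc) , inj₁ a
      where
      ids : ∀ {a b d} → Cyclic (i , a) (i , b) (k , d) → a < b
      ids (inj₁ (p , _)) = ◁⇒ids p
      ids (inj₂ (inj₁ (p , q))) = ⊥-elim (<⇒≱ (◁⇒< p i≢k) (◁⇒≤ _ _ q))
      ids (inj₂ (inj₂ (_ , p))) = ◁⇒ids p
    ... | no i≢j | yes refl = inj₁ a , inj₂ (refl , ids cyc)
      where
      ids : ∀ {a b d} → Cyclic (i , a) (j , b) (j , d) → b < d
      ids (inj₁ (_ , p)) = ◁⇒ids p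
      ids (inj₂ (inj₁ (p , _))) = ◁⇒ids p
      ids (inj₂ (inj₂ (p , q))) = ⊥-elim (<⇒≱ (◁⇒< p (i≢j ∘ sym)) (◁⇒≤ _ _ q))
    ... | no i≢j | no j≢k with Ψ.arrow-between {c , i} {c , j} {c , k} a refl
                                (subst (0 <_) (sym (Ψ.off-δ {c})) (≢⇒δ>0 i≢j))
                                (subst₂ _<_ (sym (Ψ.off-δ {c})) (sym (Ψ.off-δ {c}))
                                  (cyclic-δ i≢j j≢k (λ { refl → Ψ.arrow-irrefl a }) cyc))
    ... | b , d = inj₁ b , inj₁ d
    cyclic-spans (i , a) (j , b) (.i , d) cyc (inj₂ (refl , a<d)) with cyc
    ... | inj₂ (inj₁ (_ , p)) = ⊥-elim (<-asym a<d (◁⇒ids p))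
    ... | inj₂ (inj₂ (p , _)) = ⊥-elim (<-asym a<d (◁⇒ids p))
    ... | inj₁ (p , q) with toℕ-injective (≤-antisym (◁⇒≤ _ _ p) (◁⇒≤ _ _ q))
    ... | refl = inj₂ (refl , ◁⇒ids p) , inj₂ (refl , ◁⇒ids q)

  ⇢-same : ∀ {p q} → p ⇢ q → proj₁ (proj₁ p) ≡ proj₁ (proj₁ q)
  ⇢-same (inj₁ a) = Ψ.arrow-same a
  ⇢-same (inj₂ (refl , _)) = refl

  ⇢-linear : (∀ c → Raw.circ P c ≡ false) → ∀ {p q} → p ⇢ q → p ≺ q
  ⇢-linear lin (inj₁ a) = inj₂ (cong toℕ (Ψ.arrow-same a) , inj₁ (Ψ.arrow-linear (lin _) a))
  ⇢-linear lin (inj₂ (refl , a<b)) = inj₂ (refl , inj₂ (refl , a<b))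

  ≺-contig : ∀ {p q} → p ≺ q → toℕ (proj₁ (proj₁ p)) ≤ toℕ (proj₁ (proj₁ q))
  ≺-contig (inj₁ p) = <⇒≤ p
  ≺-contig (inj₂ (e , _)) = ≤-reflexive e

  ≺-within : ∀ {c i j a b} → ((c , i) , a) ≺ ((c , j) , b) → (i , a) ◁ (j , b)
  ≺-within (inj₁ p) = ⊥-elim (<-irrefl refl p)
  ≺-within (inj₂ (_ , p)) = p

  -- Inside one contig the three conditions are rotations of `cyclic-spans`. With two contigs
  -- involved all are linear, and each premise fails: the arrow would join different contigs or run
  -- backwards.
  ≺-spans : ∀ p q r → p ≺ q → q ≺ r → Spans _⇢_ p q r
  ≺-spans p@((c , i) , a) q@((d , j) , b) r@((e , k) , f) p≺q q≺r with c Fin.≟ d | d Fin.≟ e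
  ... | yes refl | yes refl = cyclic-spans (i , a) (j , b) (k , f) (inj₁ (l , l′))
                            , cyclic-spans (j , b) (k , f) (i , a) (inj₂ (inj₂ (l , l′)))
                            , cyclic-spans (k , f) (i , a) (j , b) (inj₂ (inj₁ (l , l′)))
    where
    l = ≺-within p≺q
    l′ = ≺-within q≺r
  ... | no c≢d | _ = (λ a → ⊥-elim (c≢d (outer a))) , (λ a → ⊥-elim (c≢d (sym (⇢-same a))))
                   , λ a → ⊥-elim (≺-asym q r q≺r (⇢-linear (linear c≢d) a))
    where
    outer : p ⇢ r → c ≡ d
    outer a = toℕ-injective (≤-antisym (≺-contig p≺q) (subst (λ x → toℕ d ≤ toℕ x) (sym (⇢-same a)) (≺-contig q≺r)))
    linear : c ≢ d → ∀ c → Raw.circ P c ≡ false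
    linear c≢d with IsRound.one-or-linear (proj₂ Ψ)
    ... | inj₁ m≡1 = ⊥-elim (c≢d (fin-unique m≡1 c d))
    ... | inj₂ lin = lin
  ... | yes c≡d | no d≢e = (λ a → ⊥-elim (d≢e (trans (sym c≡d) (⇢-same a))))
                   , (λ a → ⊥-elim (≺-asym p q p≺q (⇢-linear linear a)))
                   , λ a → ⊥-elim (d≢e (sym (⇢-same a)))
    where
    linear : ∀ c → Raw.circ P c ≡ false
    linear with IsRound.one-or-linear (proj₂ Ψ)
    ... | inj₁ m≡1 = ⊥-elim (d≢e (fin-unique m≡1 d e))
    ... | inj₂ lin = lin

-- `order` is a list standing for a circular order: `triples` speaks of increasing triples, but
-- `Spans` does not change under rotation.
record Orientation {N : ℕ} (H : Graph N) : Set₁ where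
  field
    A          : Fin N → Fin N → Set
    A?         : ∀ x y → Dec (A x y)
    asym       : ∀ {x y} → A x y → ¬ A y x
    adjacent   : ∀ {x y} → Adj H x y ⇔ (A x y ⊎ A y x)
    order      : List (Fin N)
    unique     : Unique order
    everywhere : ∀ x → x ∈ˡ order
    triples    : Triples (Spans A) order

  irrefl : ∀ {x} → ¬ A x x
  irrefl a = asym a a

  private
    module C = Contig (λ i j → A (lookup order i) (lookup order j)) (λ _ _ → A? _ _) asym (triples-lookup triples)

  pos : Fin N → Fin (length order)
  pos x = index (everywhere x)

  at-pos : ∀ x → lookup order (pos x) ≡ x
  at-pos x = sym (lookup-index (everywhere x))

  gap : Fin N → Fin N → ℕ
  gap x y = δ (pos x) (pos y)

  gap-injective : ∀ {x y z} → gap x y ≡ gap x z → y ≡ z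
  gap-injective {x} {y} {z} e = trans (sym (at-pos y)) (trans (cong (lookup order) (δ-injective {i = pos x} e)) (at-pos z))

  gap>0 : ∀ {x y} → x ≢ y → 0 < gap x y
  gap>0 {x} {y} x≢y = ≢⇒δ>0 λ e → x≢y (trans (sym (at-pos x)) (trans (cong (lookup order) e) (at-pos y)))

  gap-spans : ∀ {x y z} → x ≢ y → gap x y < gap x z → Spans A x y z
  gap-spans {x} {y} {z} x≢y lt with C.cyclic-spans (gap>0 x≢y) lt
  ... | s rewrite at-pos x | at-pos y | at-pos z = s

  -- Three distinct vertices have just two circular orders; most later arguments are case
  -- distinctions of this kind.
  spans-or : ∀ {x y z} → x ≢ y → y ≢ z → x ≢ z → Spans A x y z ⊎ Spans A x z y
  spans-or {x} {y} {z} x≢y y≢z x≢z with <-cmp (gap x y) (gap x z)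
  ... | tri< lt _ _ = inj₁ (gap-spans x≢y lt)
  ... | tri≈ _ e _ = ⊥-elim (y≢z (gap-injective {x} e))
  ... | tri> _ _ gt = inj₂ (gap-spans x≢z gt)

  A⇒≢ : ∀ {x y} → A x y → x ≢ y
  A⇒≢ a refl = irrefl a

  -- If `y` came before `u`, the arrow `x → u` would contain `y → u`.
  gap-ordered : ∀ {x u y} → A x u → A x y → A u y → gap x u < gap x y
  gap-ordered {x} {u} {y} xu xy uy with <-cmp (gap x u) (gap x y)
  ... | tri< lt _ _ = lt
  ... | tri≈ _ e _ = ⊥-elim (A⇒≢ uy (gap-injective {x} e))
  ... | tri> _ _ gt = ⊥-elim (asym uy (proj₂ (proj₁ (gap-spans (A⇒≢ xy) gt) xu)))

  -- Along the circle: x, u, v, y.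
  leave : ∀ {x u v y} → A x u → A u v → A x v → A v y → A x y → A u y
  leave xu uv xv vy xy = proj₂ (proj₁ (gap-spans (A⇒≢ xu) (<-trans (gap-ordered xu xv uv) (gap-ordered xv xy vy))) xy)

  -- Along the circle: x, v, u, y.
  enter : ∀ {x v u y} → A x v → A v u → A u y → A v y → A x y → A x u
  enter {x} {v} {u} {y} xv vu uy vy xy = proj₁ (proj₁ (gap-spans x≢u (subst₂ _<_ (sym xu) xy′ vu<vy)) xy)
    where
    xy′ : gap x v + gap v y ≡ gap x y
    xy′ = δ-splitˡ (pos x) (pos v) (pos y) (<⇒≤ (gap-ordered xv xy vy))
    vu<vy : gap x v + gap v u < gap x v + gap v y
    vu<vy = +-monoʳ-< (gap x v) (gap-ordered vu vy uy)
    xu : gap x u ≡ gap x v + gap v u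
    xu = δ-add (pos x) (pos v) (pos u) (<-trans vu<vy (subst (_< length order) (sym xy′) (δ<n (pos x) (pos y))))
    x≢u : x ≢ u
    x≢u refl = asym xv vu

orientation : ∀ {N} (H : Graph N) → PCA H → Orientation H
orientation {N} H (M , Ψ , f , f-inj , image , adjacency) = record
  { A = A ; A? = λ x y → pt x ⇢? pt y ; asym = λ {x} {y} → ⇢-asym (pt x) (pt y)
  ; adjacent = λ {x} {y} → mk⇔ (fwd x y) (bwd x y)
  ; order = order
  ; unique = unique
  ; everywhere = λ x → ∈-resp-↭ (↭-sym (sort-↭ (allFin N))) (∈-allFin x)
  ; triples = triples-allPairs (λ {x} {y} {z} p _ q → ≺-spans (pt x) (pt y) (pt z) p q) ordered }
  where
  open Pointwise Ψ
  module Ψ = Round (rw Ψ) (proj₂ Ψ)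
  block : ∀ x → InV (rw Ψ) (f x)
  block x = from (image (f x)) (x , refl)
  pt : Fin N → Point
  pt x = proj₁ (block x) , toℕ x
  A : Fin N → Fin N → Set
  A x y = pt x ⇢ pt y
  fwd : ∀ x y → Adj H x y → A x y ⊎ A y x
  fwd x y a with to (adjacency x y) a
  ... | fx≢fy , s , t , fx∈s , fy∈t , rel with Ψ.block-unique fx∈s (proj₂ (block x)) | Ψ.block-unique fy∈t (proj₂ (block y)) | rel
  ... | refl | refl | inj₂ (inj₁ b) = inj₁ (inj₁ (Ψ.arrow b))
  ... | refl | refl | inj₂ (inj₂ b) = inj₂ (inj₁ (Ψ.arrow b))
  ... | refl | refl | inj₁ e with <-cmp (toℕ x) (toℕ y)
  ... | tri< x<y _ _ = inj₁ (inj₂ (e , x<y))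
  ... | tri≈ _ x≡y _ = ⊥-elim (fx≢fy (cong f (toℕ-injective x≡y)))
  ... | tri> _ _ y<x = inj₂ (inj₂ (sym e , y<x))
  bwd₁ : ∀ x y → A x y → Adj H x y
  bwd₁ x y a = from (adjacency x y) ((λ e → distinct (f-inj e) a) , _ , _ , proj₂ (block x) , proj₂ (block y) , rel a)
    where
    distinct : x ≡ y → ¬ A x y
    distinct refl a = ⇢-asym (pt x) (pt x) a a
    rel : A x y → _ ⊎ _ ⊎ _
    rel (inj₁ (Ψ.arrow b)) = inj₂ (inj₁ b)
    rel (inj₂ (e , _)) = inj₁ e
  bwd : ∀ x y → A x y ⊎ A y x → Adj H x y
  bwd x y (inj₁ a) = bwd₁ x y a
  bwd x y (inj₂ a) = Adj-sym H (bwd₁ y x a)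
  -- Contig, position in the contig, vertex number: the non-strict form of `≺`, which absence of
  -- repetitions makes strict.
  lex : DecTotalOrder 0ℓ 0ℓ 0ℓ
  lex = On.decTotalOrder (×-decTotalOrder ≤-decTotalOrder (×-decTotalOrder ≤-decTotalOrder ≤-decTotalOrder))
          (λ x → toℕ (proj₁ (proj₁ (pt x))) , toℕ (proj₂ (proj₁ (pt x))) , toℕ x)
  open DecTotalOrder lex using () renaming (_≤_ to _≼_; totalOrder to lex-total)
  open Sort lex using (sort; sort-↭; sort-↗)
  order = sort (allFin N)
  unique : Unique order
  unique = Permₛ.Unique-resp-↭ (setoid _) (↭⇒↭ₛ (↭-sym (sort-↭ (allFin N)))) (allFin⁺ N)
  strict : ∀ {x y} → x ≼ y → x ≢ y → pt x ≺ pt y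
  strict (inj₁ (p , q)) _ = inj₁ (≤∧≢⇒< p q)
  strict (inj₂ (e , inj₁ (p , q))) _ = inj₂ (e , inj₁ (≤∧≢⇒< p q))
  strict (inj₂ (e , inj₂ (e′ , p))) x≢y = inj₂ (e , inj₂ (e′ , ≤∧≢⇒< p (x≢y ∘ toℕ-injective)))
  ordered : AllPairs (λ x y → pt x ≺ pt y) order
  ordered = AllPairs.zipWith (λ (p , q) → strict p q) (Sortedₚ.Sorted⇒AllPairs lex-total (sort-↗ (allFin N)) , unique)

-- Twin classes and the receptive representation

subset : ∀ {N} {P : Fin N → Set} → (∀ x → Dec (P x)) → Subset N
subset P? = tabulate (λ x → does (P? x))

∈subset⁺ : ∀ {N} {P : Fin N → Set} (P? : ∀ x → Dec (P x)) {x} → P x → x ∈ subset P?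
∈subset⁺ P? {x} p = lookup⇒[]= x (subset P?) (trans (lookup∘tabulate (λ y → does (P? y)) x) (dec-true (P? x) p))

∈subset⁻ : ∀ {N} {P : Fin N → Set} (P? : ∀ x → Dec (P x)) {x} → x ∈ subset P? → P x
∈subset⁻ P? {x} x∈ with P? x | trans (sym (lookup∘tabulate (λ y → does (P? y)) x)) ([]=⇒lookup x∈)
... | yes p | _ = p

module Forward {N : ℕ} (H : Graph N) (v : Fin N) (O : Orientation H) where
  open Orientation O

  Adj⁺ : Fin N → Fin N → Set
  Adj⁺ x y = x ≡ y ⊎ Adj H x y

  Adj⁺? : ∀ x y → Dec (Adj⁺ x y)
  Adj⁺? x y = (x Fin.≟ y) ⊎-dec Adj? H x y

  Adj⁺-sym : ∀ {x y} → Adj⁺ x y → Adj⁺ y x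
  Adj⁺-sym (inj₁ e) = inj₁ (sym e)
  Adj⁺-sym (inj₂ a) = inj₂ (Adj-sym H a)

  Adj⁺⇒A : ∀ {x y} → Adj⁺ x y → x ≡ y ⊎ A x y ⊎ A y x
  Adj⁺⇒A (inj₁ e) = inj₁ e
  Adj⁺⇒A (inj₂ a) = inj₂ (to adjacent a)

  A⇒Adj⁺ : ∀ {x y} → x ≡ y ⊎ A x y ⊎ A y x → Adj⁺ x y
  A⇒Adj⁺ (inj₁ e) = inj₁ e
  A⇒Adj⁺ (inj₂ a) = inj₂ (from adjacent a)

  Twin : Fin N → Fin N → Set
  Twin x y = ∀ z → (Adj⁺ x z → Adj⁺ y z) × (Adj⁺ y z → Adj⁺ x z)

  Twin? : ∀ x y → Dec (Twin x y)
  Twin? x y = all? λ z → (Adj⁺? x z →-dec Adj⁺? y z) ×-dec (Adj⁺? y z →-dec Adj⁺? x z)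

  twin-refl : ∀ {x} → Twin x x
  twin-refl z = (λ a → a) , λ a → a

  twin-sym : ∀ {x y} → Twin x y → Twin y x
  twin-sym t z = proj₂ (t z) , proj₁ (t z)

  twin-trans : ∀ {x y z} → Twin x y → Twin y z → Twin x z
  twin-trans t t′ w = proj₁ (t′ w) ∘ proj₁ (t w) , proj₂ (t w) ∘ proj₂ (t′ w)

  twin-adj : ∀ {a b x y} → Twin a x → Twin b y → Adj⁺ a b → Adj⁺ x y
  twin-adj {b = b} t t′ e = Adj⁺-sym (proj₁ (t′ _) (Adj⁺-sym (proj₁ (t b) e)))

  -- The least vertex of each twin class; v is kept apart from its own class.
  Rep : Fin N → Set
  Rep x = x ≢ v × (∀ y → toℕ y < toℕ x → y ≢ v → ¬ Twin x y)

  Rep⁺ : Fin N → Set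
  Rep⁺ x = x ≡ v ⊎ Rep x

  Rep? : ∀ x → Dec (Rep x)
  Rep? x = ¬? (x Fin.≟ v) ×-dec all? λ y → (toℕ y <? toℕ x) →-dec (¬? (y Fin.≟ v) →-dec ¬? (Twin? x y))

  Rep⁺? : ∀ x → Dec (Rep⁺ x)
  Rep⁺? x = (x Fin.≟ v) ⊎-dec Rep? x

  rep-unique : ∀ {x y} → Rep x → Rep y → Twin x y → x ≡ y
  rep-unique {x} {y} (x≢v , least-x) (y≢v , least-y) t with <-cmp (toℕ x) (toℕ y)
  ... | tri< x<y _ _ = ⊥-elim (least-y x x<y x≢v (twin-sym t))
  ... | tri≈ _ e _ = toℕ-injective e
  ... | tri> _ _ y<x = ⊥-elim (least-x y y<x y≢v t)

  representative : ∀ x → x ≢ v → ∃ λ r → Rep r × Twin r x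
  representative x x≢v = go x x≢v (<-wellFounded (toℕ x))
    where
    go : ∀ x → x ≢ v → Acc _<_ (toℕ x) → ∃ λ r → Rep r × Twin r x
    go x x≢v (acc rec) with any? (λ y → (toℕ y <? toℕ x) ×-dec (¬? (y Fin.≟ v) ×-dec Twin? x y))
    ... | no none = x , (x≢v , λ y y<x y≢v t → none (y , y<x , y≢v , t)) , twin-refl
    ... | yes (y , y<x , y≢v , t) with go y y≢v (rec y<x)
    ... | r , rep-r , t′ = r , rep-r , twin-trans t′ (twin-sym t)

  InClass : Fin N → Fin N → Set
  InClass x y = y ≢ v × Twin x y

  InClass? : ∀ x y → Dec (InClass x y)
  InClass? x y = ¬? (y Fin.≟ v) ×-dec Twin? x y

  cls : Fin N → Subset N
  cls x with x Fin.≟ v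
  ... | yes _ = ⁅ v ⁆
  ... | no _ = subset (InClass? x)

  cls-v : cls v ≡ ⁅ v ⁆
  cls-v with v Fin.≟ v
  ... | yes _ = refl
  ... | no v≢v = ⊥-elim (v≢v refl)

  ∈cls⁻ : ∀ {x y} → y ∈ cls x → (x ≡ v × y ≡ v) ⊎ (x ≢ v × InClass x y)
  ∈cls⁻ {x} y∈ with x Fin.≟ v
  ... | yes e = inj₁ (e , x∈⁅y⁆⇒x≡y v y∈)
  ... | no x≢v = inj₂ (x≢v , ∈subset⁻ (InClass? x) y∈)

  ∈cls⁺ : ∀ {x y} → x ≢ v → InClass x y → y ∈ cls x
  ∈cls⁺ {x} x≢v c with x Fin.≟ v
  ... | yes e = ⊥-elim (x≢v e)
  ... | no _ = ∈subset⁺ (InClass? x) c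

  ∈cls-self : ∀ x → x ∈ cls x
  ∈cls-self x with x Fin.≟ v
  ... | yes refl = x∈⁅x⁆ v
  ... | no x≢v = ∈subset⁺ (InClass? x) (x≢v , twin-refl)

  ∈cls⇒twin : ∀ {x y} → y ∈ cls x → Twin x y
  ∈cls⇒twin {x} y∈ with ∈cls⁻ {x} y∈
  ... | inj₁ (refl , refl) = twin-refl
  ... | inj₂ (_ , _ , t) = t

  cls-disjoint : ∀ {x y u} → Rep⁺ x → Rep⁺ y → u ∈ cls x → u ∈ cls y → x ≡ y
  cls-disjoint {x} {y} x∈ y∈ u∈x u∈y with ∈cls⁻ {x} u∈x | ∈cls⁻ {y} u∈y | x∈ | y∈
  ... | inj₁ (e , _) | inj₁ (e′ , _) | _ | _ = trans e (sym e′)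
  ... | inj₁ (_ , e) | inj₂ (_ , u≢v , _) | _ | _ = ⊥-elim (u≢v e)
  ... | inj₂ (_ , u≢v , _) | inj₁ (_ , e) | _ | _ = ⊥-elim (u≢v e)
  ... | inj₂ (x≢v , _) | inj₂ _ | inj₁ e | _ = ⊥-elim (x≢v e)
  ... | inj₂ _ | inj₂ (y≢v , _) | inj₂ _ | inj₁ e = ⊥-elim (y≢v e)
  ... | inj₂ (_ , _ , t) | inj₂ (_ , _ , t′) | inj₂ rx | inj₂ ry = rep-unique rx ry (twin-trans t (twin-sym t′))

  module Build {S : Fin N → Set} (S? : ∀ x → Dec (S x)) (S⊆ : ∀ {x} → S x → Rep⁺ x) where

    S-layout : Layout A S
    S-layout = layout-⊆ A? irrefl (λ x∈ → proj₂ (∈-filter⁻ S? {xs = order} x∈)) (λ {x} s → ∈-filter⁺ S? (everywhere x) s)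
      (layout A? irrefl (filter S? order) (triples-filter S? triples) (filter⁺ S? unique))

    module R = Realise A? asym S-layout cls (λ x _ → x , ∈cls-self x) (λ sx sy → cls-disjoint (S⊆ sx) (S⊆ sy))

    rep : RoundRep N
    rep = R.raw , R.isRound

    realises : Realises rep A S cls
    realises = R.realises

  module Represented {Θ : RoundRep N} {S : Fin N → Set} (Z : Realises Θ A S cls) where
    open Realises Z

    ∈block⁻ : ∀ {x s} → x ∈ Blk (rw Θ) s → x ∈ cls (rep s)
    ∈block⁻ {x} {s} = subst (x ∈_) (block s)

    ∈block⁺ : ∀ {x s} → x ∈ cls (rep s) → x ∈ Blk (rw Θ) s
    ∈block⁺ {x} {s} = subst (x ∈_) (sym (block s))

    located : ∀ {x a} → S a → x ∈ cls a → InV (rw Θ) x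
    located {x} {a} a∈ x∈ with complete a a∈
    ... | s , refl = s , ∈block⁺ x∈

    -- A block consists of twins of its representative, so `twin-adj` moves between vertices and
    -- representatives. Reflexivity of `Adj⁺` takes care of two vertices in one block.
    adjacency : ∀ {x y} → InV (rw Θ) x → InV (rw Θ) y → GAdj (rw Θ) x y ⇔ Adj H x y
    adjacency {x} {y} (s , x∈s) (t , y∈t) = mk⇔ fwd bwd
      where
      fwd : GAdj (rw Θ) x y → Adj H x y
      fwd (x≢y , s , t , x∈s , y∈t , rel) with twin-adj (∈cls⇒twin (∈block⁻ x∈s)) (∈cls⇒twin (∈block⁻ y∈t)) (A⇒Adj⁺ (related rel))
        where
        related : s ≡ t ⊎ Arrow (rw Θ) s t ⊎ Arrow (rw Θ) t s → rep s ≡ rep t ⊎ A (rep s) (rep t) ⊎ A (rep t) (rep s)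
        related (inj₁ e) = inj₁ (cong rep e)
        related (inj₂ (inj₁ a)) = inj₂ (inj₁ (to (arrow s t) a))
        related (inj₂ (inj₂ a)) = inj₂ (inj₂ (to (arrow t s) a))
      ... | inj₁ e = ⊥-elim (x≢y e)
      ... | inj₂ a = a
      bwd : Adj H x y → GAdj (rw Θ) x y
      bwd a = (λ { refl → Adj-irrefl H a }) , s , t , x∈s , y∈t ,
        related (Adj⁺⇒A (twin-adj (twin-sym (∈cls⇒twin (∈block⁻ x∈s))) (twin-sym (∈cls⇒twin (∈block⁻ y∈t))) (inj₂ a)))
        where
        related : rep s ≡ rep t ⊎ A (rep s) (rep t) ⊎ A (rep t) (rep s) → s ≡ t ⊎ Arrow (rw Θ) s t ⊎ Arrow (rw Θ) t s
        related (inj₁ e) = inj₁ (rep-inj e)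
        related (inj₂ (inj₁ a)) = inj₂ (inj₁ (from (arrow s t) a))
        related (inj₂ (inj₂ a)) = inj₂ (inj₂ (from (arrow t s) a))

  -- The form in which indistinguishability of blocks is used: restricted to the representatives, a
  -- vertex dominating y is a twin of y, and so is everything between them.
  Dominates : Fin N → Fin N → Set
  Dominates x y = A x y × (∀ w → Rep w → A w x → A w y) × (∀ w → Rep w → A y w → A x w)

  TwinOnReps : Fin N → Fin N → Set
  TwinOnReps x y = ∀ w → Rep w → (Adj⁺ x w → Adj⁺ y w) × (Adj⁺ y w → Adj⁺ x w)

  -- Arrows `w → x` and `y → w` are carried over by domination. For `x → w` and `w → y`, the
  -- circular order of `x`, `y`, `w` decides which arrow contains the other, and either way `w`
  -- meets both.
  dominates⇒twin : ∀ {x y} → Dominates x y → TwinOnReps x y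
  dominates⇒twin {x} {y} (xy , into , out) w r = A⇒Adj⁺ ∘ fwd ∘ Adj⁺⇒A , A⇒Adj⁺ ∘ bwd ∘ Adj⁺⇒A
    where
    fwd : x ≡ w ⊎ A x w ⊎ A w x → y ≡ w ⊎ A y w ⊎ A w y
    fwd (inj₁ refl) = inj₂ (inj₂ xy)
    fwd (inj₂ (inj₂ wx)) = inj₂ (inj₂ (into w r wx))
    fwd (inj₂ (inj₁ xw)) with y Fin.≟ w
    ... | yes e = inj₁ e
    ... | no y≢w with spans-or (A⇒≢ xy) y≢w (A⇒≢ xw)
    ... | inj₁ s = inj₂ (inj₁ (proj₂ (proj₁ s xw)))
    ... | inj₂ s = inj₂ (inj₂ (proj₂ (proj₁ s xy)))
    bwd : y ≡ w ⊎ A y w ⊎ A w y → x ≡ w ⊎ A x w ⊎ A w x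
    bwd (inj₁ refl) = inj₂ (inj₁ xy)
    bwd (inj₂ (inj₁ yw)) = inj₂ (inj₁ (out w r yw))
    bwd (inj₂ (inj₂ wy)) with x Fin.≟ w
    ... | yes e = inj₁ e
    ... | no x≢w with spans-or x≢w (A⇒≢ wy) (A⇒≢ xy)
    ... | inj₁ s = inj₂ (inj₁ (proj₁ (proj₁ s xy)))
    ... | inj₂ s = inj₂ (inj₂ (proj₁ (proj₂ (proj₂ s) wy)))

  -- In-arrows: `w → x` gives `w → y`, which passes over `z`. Out-arrows: an arrow `z → w` goes
  -- beyond `y`, where domination applies, or ends before `y` and hence within `x → y`.
  dominates-between : ∀ {x y z} → Dominates x y → A x z → A z y → Dominates x z
  dominates-between {x} {y} {z} (xy , into , out) xz zy = xz , (λ w r wx → enter wx xz zy xy (into w r wx)) , out′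
    where
    out′ : ∀ w → Rep w → A z w → A x w
    out′ w r zw with y Fin.≟ w
    ... | yes refl = xy
    ... | no y≢w with spans-or (A⇒≢ zy) y≢w (A⇒≢ zw)
    ... | inj₁ s = out w r (proj₂ (proj₁ s zw))
    ... | inj₂ s = enter xz zw (proj₂ (proj₁ s zy)) zy xy

  -- Every vertex other than `v` is a twin of a representative, so agreement on the representatives
  -- and on `v` is agreement everywhere.
  twin-reps : ∀ {x y} → Rep x → Rep y → TwinOnReps x y → (Adj⁺ x v → Adj⁺ y v) → (Adj⁺ y v → Adj⁺ x v) → x ≡ y
  twin-reps {x} {y} rx ry t f g = rep-unique rx ry λ w → extend (λ u r → proj₁ (t u r)) f w , extend (λ u r → proj₂ (t u r)) g w
    where
    extend : ∀ {x y} → (∀ w → Rep w → Adj⁺ x w → Adj⁺ y w) → (Adj⁺ x v → Adj⁺ y v) → ∀ w → Adj⁺ x w → Adj⁺ y w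
    extend h h-v w a with w Fin.≟ v
    ... | yes refl = h-v a
    ... | no w≢v with representative w w≢v
    ... | r , rep-r , tw = twin-adj twin-refl tw (h r rep-r (twin-adj twin-refl (twin-sym tw) a))

  -- Deleting `v`: the two realisations compared

  module Compare (Ψ Φ : RoundRep N) (Ψ-real : Realises Ψ A Rep⁺ cls) (Φ-real : Realises Φ A Rep cls) where

    private
      module RΨ = Realises Ψ-real
      module RΦ = Realises Φ-real
      module GΨ = Represented Ψ-real
      module GΦ = Represented Φ-real
      module Ψ = Round (rw Ψ) (proj₂ Ψ)
      module Φ = Round (rw Φ) (proj₂ Φ)

    covers : ∀ x → InV (rw Ψ) x
    covers x with x Fin.≟ v
    ... | yes refl = GΨ.located (inj₁ refl) (∈cls-self v)
    ... | no x≢v with representative x x≢v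
    ... | r , rep-r , t = GΨ.located (inj₂ rep-r) (∈cls⁺ (proj₁ rep-r) (x≢v , t))

    Ψ-represents : RepresentsG Ψ H
    Ψ-represents = covers , λ x y → GΨ.adjacency (covers x) (covers y)

    covers⁻ : ∀ {x} → x ≢ v → InV (rw Φ) x
    covers⁻ {x} x≢v with representative x x≢v
    ... | r , rep-r , t = GΦ.located rep-r (∈cls⁺ (proj₁ rep-r) (x≢v , t))

    misses-v : ∀ {x} → InV (rw Φ) x → x ≢ v
    misses-v (s , x∈s) with ∈cls⁻ {RΦ.rep s} (GΦ.∈block⁻ x∈s)
    ... | inj₁ (e , _) = ⊥-elim (proj₁ (RΦ.sound s) e)
    ... | inj₂ (_ , x≢v , _) = x≢v

    Φ-represents : RepresentsMinus Φ H v
    Φ-represents = (λ x → mk⇔ misses-v covers⁻) , λ x y x≢v y≢v → GΦ.adjacency (covers⁻ x≢v) (covers⁻ y≢v)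

    sv : Sb (rw Ψ)
    sv = proj₁ (RΨ.complete v (inj₁ refl))

    rep-sv : RΨ.rep sv ≡ v
    rep-sv = proj₂ (RΨ.complete v (inj₁ refl))

    sv-block : Blk (rw Ψ) sv ≡ ⁅ v ⁆
    sv-block = trans (RΨ.block sv) (trans (cong cls rep-sv) cls-v)

    corr⇒rep : ∀ {s t} → Corr Ψ sv Φ s t → RΦ.rep s ≡ RΨ.rep t
    corr⇒rep {s} {t} e = cls-disjoint {u = RΦ.rep s} (inj₂ (RΦ.sound s)) (RΨ.sound t) (∈cls-self _)
      (subst (RΦ.rep s ∈_) (trans (sym (RΦ.block s)) (trans e (RΨ.block t))) (∈cls-self _))

    rep⇒corr : ∀ {s t} → RΦ.rep s ≡ RΨ.rep t → Corr Ψ sv Φ s t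
    rep⇒corr {s} {t} e = trans (RΦ.block s) (trans (cong cls e) (sym (RΨ.block t)))

    up : (s : Sb (rw Φ)) → ∃ λ t → Corr Ψ sv Φ s t × t ≢ sv
    up s with RΨ.complete (RΦ.rep s) (inj₂ (RΦ.sound s))
    ... | t , e = t , rep⇒corr (sym e) , λ { refl → proj₁ (RΦ.sound s) (trans (sym e) rep-sv) }

    down : (t : Sb (rw Ψ)) → t ≢ sv → ∃ λ s → Corr Ψ sv Φ s t
    down t t≢sv with RΨ.sound t
    ... | inj₁ e = ⊥-elim (t≢sv (RΨ.rep-inj (trans e (sym rep-sv))))
    ... | inj₂ r with RΦ.complete (RΨ.rep t) r
    ... | s , e = s , rep⇒corr e

    -- Restoring `v` can destroy a covering only by lying between `x` and `y` itself. Then anything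
    -- between `x` and `v`, or between `v` and `y`, is also between `x` and `y` by `leave` and
    -- `enter`.
    covers-delete : ∀ {x y} → Covers A Rep x y → Covers A Rep⁺ x y ⊎ (Covers A Rep⁺ x v × Covers A Rep⁺ v y × A x y)
    covers-delete {x} {y} (xy , none) with A? x v ×-dec A? v y
    ... | no ¬v = inj₁ (xy , λ { u (inj₁ refl) → ¬v ; u (inj₂ r) → none u r })
    ... | yes (xv , vy) = inj₂ ((xv , left) , (vy , right) , xy)
      where
      left : ∀ u → Rep⁺ u → ¬ (A x u × A u v)
      left u (inj₁ refl) (_ , uv) = irrefl uv
      left u (inj₂ r) (xu , uv) = none u r (xu , leave xu uv xv vy xy)
      right : ∀ u → Rep⁺ u → ¬ (A v u × A u y)
      right u (inj₁ refl) (vu , _) = irrefl vu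
      right u (inj₂ r) (vu , uy) = none u r (enter xv vu uy vy xy , uy)

    -- A vertex `u` between `x` and `y` falls on one side of `v` and breaks the covering on that
    -- side.
    covers-restore : ∀ {x y} → Covers A Rep⁺ x y ⊎ (Covers A Rep⁺ x v × Covers A Rep⁺ v y × A x y) → Covers A Rep x y
    covers-restore (inj₁ (xy , none)) = xy , λ u r → none u (inj₂ r)
    covers-restore {x} {y} (inj₂ ((xv , none) , (vy , none′) , xy)) = xy , λ u r (xu , uy) → split u r xu uy
      where
      split : ∀ u → Rep u → A x u → A u y → ⊥
      split u r xu uy with spans-or (A⇒≢ xu) (proj₁ r) (A⇒≢ xv)
      ... | inj₁ s = none u (inj₂ r) (proj₁ s xv)
      ... | inj₂ s = none′ u (inj₂ r) (proj₂ (proj₁ s xu) , uy)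

    deleted : Deleted Ψ sv Φ
    deleted = record
      { del-from = up
      ; del-to = down
      ; arrows = λ s s′ t t′ e e′ → mk⇔
          (λ a → from (RΨ.arrow t t′) (subst₂ A (corr⇒rep e) (corr⇒rep e′) (to (RΦ.arrow s s′) a)))
          (λ a → from (RΦ.arrow s s′) (subst₂ A (sym (corr⇒rep e)) (sym (corr⇒rep e′)) (to (RΨ.arrow t t′) a)))
      ; order = λ s s′ t t′ e e′ → mk⇔
          (λ r → lower t t′ (covers-delete (subst₂ (Covers A Rep) (corr⇒rep e) (corr⇒rep e′) (to (RΦ.rightOf s s′) r))))
          (λ r → from (RΦ.rightOf s s′) (subst₂ (Covers A Rep) (sym (corr⇒rep e)) (sym (corr⇒rep e′)) (covers-restore (lift t t′ r))))
      }
      where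
      Vertexwise : Sb (rw Ψ) → Sb (rw Ψ) → Set
      Vertexwise t t′ = Covers A Rep⁺ (RΨ.rep t) (RΨ.rep t′)
        ⊎ (Covers A Rep⁺ (RΨ.rep t) v × Covers A Rep⁺ v (RΨ.rep t′) × A (RΨ.rep t) (RΨ.rep t′))
      Blockwise : Sb (rw Ψ) → Sb (rw Ψ) → Set
      Blockwise t t′ = RightOf (rw Ψ) t t′ ⊎ (RightOf (rw Ψ) t sv × RightOf (rw Ψ) sv t′ × Arrow (rw Ψ) t t′)
      lower : ∀ t t′ → Vertexwise t t′ → Blockwise t t′
      lower t t′ (inj₁ c) = inj₁ (from (RΨ.rightOf t t′) c)
      lower t t′ (inj₂ (c , c′ , a)) = inj₂ (from (RΨ.rightOf t sv) (subst (Covers A Rep⁺ (RΨ.rep t)) (sym rep-sv) c)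
        , from (RΨ.rightOf sv t′) (subst (λ x → Covers A Rep⁺ x (RΨ.rep t′)) (sym rep-sv) c′) , from (RΨ.arrow t t′) a)
      lift : ∀ t t′ → Blockwise t t′ → Vertexwise t t′
      lift t t′ (inj₁ r) = inj₁ (to (RΨ.rightOf t t′) r)
      lift t t′ (inj₂ (r , r′ , a)) = inj₂ (subst (Covers A Rep⁺ (RΨ.rep t)) rep-sv (to (RΨ.rightOf t sv) r)
        , subst (λ x → Covers A Rep⁺ x (RΨ.rep t′)) rep-sv (to (RΨ.rightOf sv t′) r′) , to (RΨ.arrow t t′) a)

    private
      sv≡ : ∀ {x t} → x ∈ Blk (rw Ψ) t → x ≡ v → t ≡ sv
      sv≡ {t = t} x∈ refl = Ψ.block-unique x∈ (subst (v ∈_) (sym sv-block) (x∈⁅x⁆ v))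

      ▸⇒⟶ : ∀ {s t} → s Ψ.▸ t → s Ψ.⟶ t
      ▸⇒⟶ {s} {t} (Ψ.right r) = Ψ.arrow (from (RΨ.arrow s t) (proj₁ (to (RΨ.rightOf s t) r)))

      ⟶-v : ∀ {s} → A (RΨ.rep s) v → s Ψ.⟶ sv
      ⟶-v {s} a = Ψ.arrow (from (RΨ.arrow s sv) (subst (A _) (sym rep-sv) a))

      v-⟶ : ∀ {s} → A v (RΨ.rep s) → sv Ψ.⟶ s
      v-⟶ {s} a = Ψ.arrow (from (RΨ.arrow sv s) (subst (λ x → A x (RΨ.rep s)) (sym rep-sv) a))

      ⟶-v⁻ : ∀ {s} → s Ψ.⟶ sv → A (RΨ.rep s) v
      ⟶-v⁻ {s} (Ψ.arrow a) = subst (A _) rep-sv (to (RΨ.arrow s sv) a)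

      v-⟶⁻ : ∀ {s} → sv Ψ.⟶ s → A v (RΨ.rep s)
      v-⟶⁻ {s} (Ψ.arrow a) = subst (λ x → A x (RΨ.rep s)) rep-sv (to (RΨ.arrow sv s) a)

    neighbour : NonIsolated H v → ∃ λ t → sv Ψ.⟶ t ⊎ t Ψ.⟶ sv
    neighbour (u , a) with from (proj₂ Ψ-represents v u) a
    ... | v≢u , s , t , v∈s , u∈t , rel with sv≡ v∈s refl | rel
    ... | refl | inj₁ refl = ⊥-elim (v≢u (sym (x∈⁅y⁆⇒x≡y v (subst (u ∈_) sv-block u∈t))))
    ... | refl | inj₂ (inj₁ b) = t , inj₁ (Ψ.arrow b)
    ... | refl | inj₂ (inj₂ b) = t , inj₂ (Ψ.arrow b)

    -- At a left end every neighbour lies to the right, so non-isolation supplies `R(v)`; elsewhere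
    -- `L(v) → v` shows that the left far neighbour is not `{v}`. The last component, vacuous at a
    -- left end, makes the choice the farthest in-neighbour.
    choose-left : NonIsolated H v → ∃ λ t → t ≢ sv ×
      ((¬ LeftEnd (rw Ψ) sv × IsFl (rw Ψ) sv t) ⊎ (LeftEnd (rw Ψ) sv × RightOf (rw Ψ) sv t)) ×
      (∀ {w} → w Ψ.⟶ sv → t Ψ.⟶ sv × (w ≡ t ⊎ t Ψ.⟶ w))
    choose-left ni with Ψ.LeftEnd? sv
    choose-left ni | no ¬e with Ψ.far-left sv | Ψ.¬LeftEnd⇒prev ¬e
    ... | f , fl | p , r = f , (λ { refl → Ψ.arrow-irrefl (proj₁ (Ψ.Fl-farthest fl (▸⇒⟶ r))) }) , inj₁ (¬e , fl)
                         , Ψ.Fl-farthest fl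
    choose-left ni | yes e with neighbour ni
    ... | t , inj₂ b = ⊥-elim (Ψ.LeftEnd-source e b)
    ... | t , inj₁ b with Ψ.arrow⇒next b
    ... | q , r@(Ψ.right r′) = q , (λ { refl → Ψ.arrow-irrefl (▸⇒⟶ r) }) , inj₂ (e , r′) , λ c → ⊥-elim (Ψ.LeftEnd-source e c)

    choose-right : NonIsolated H v → ∃ λ t → t ≢ sv ×
      ((¬ RightEnd (rw Ψ) sv × t ≡ FrSb (rw Ψ) sv) ⊎ (RightEnd (rw Ψ) sv × RightOf (rw Ψ) t sv)) ×
      (∀ {w} → sv Ψ.⟶ w → sv Ψ.⟶ t × (w ≡ t ⊎ w Ψ.⟶ t))
    choose-right ni with Ψ.RightEnd? sv
    choose-right ni | no ¬e with Ψ.¬RightEnd⇒next ¬e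
    ... | p , r = FrSb (rw Ψ) sv
                , (λ e → Ψ.arrow-irrefl (subst (sv Ψ.⟶_) e (proj₁ (Ψ.Fr-farthest (▸⇒⟶ r))))) , inj₁ (¬e , refl)
                , Ψ.Fr-farthest
    choose-right ni | yes e with neighbour ni
    ... | t , inj₁ b = ⊥-elim (Ψ.RightEnd-sink e b)
    ... | t , inj₂ b with Ψ.arrow⇒prev b
    ... | q , r@(Ψ.right r′) = q , (λ { refl → Ψ.arrow-irrefl (▸⇒⟶ r) }) , inj₂ (e , r′) , λ c → ⊥-elim (Ψ.RightEnd-sink e c)

    module _ (ni : NonIsolated H v) where

      private
        tl = proj₁ (choose-left ni)
        tr = proj₁ (choose-right ni)
        tl-down = down tl (proj₁ (proj₂ (choose-left ni)))
        tr-down = down tr (proj₁ (proj₂ (choose-right ni)))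

      bl br : Sb (rw Φ)
      bl = proj₁ tl-down
      br = proj₁ tr-down

      reception : IsReception Φ v bl br Ψ
      reception = sv , sv-block , deleted
        , (tl , sym (proj₂ tl-down) , proj₁ (proj₂ (proj₂ (choose-left ni))))
        , (tr , sym (proj₂ tr-down) , proj₁ (proj₂ (proj₂ (choose-right ni))))

      neighbourhood : ∀ x → Adj H v x ⇔ (∃ λ s → InRange (rw Φ) bl br s × x ∈ Blk (rw Φ) s)
      neighbourhood x = mk⇔
        (λ a → to (adjacent-v x) (from (proj₂ Ψ-represents v x) a))
        (λ i → to (proj₂ Ψ-represents v x) (from (adjacent-v x) i))
        where open Reception Φ Ψ v bl br reception using (adjacent-v)

      zl zr : Fin N
      zl = RΦ.rep bl
      zr = RΦ.rep br

      leftmost : ∀ {w} → Rep w → A w v → A zl v × (w ≡ zl ⊎ A zl w)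
      leftmost {w} r a with RΨ.complete w (inj₂ r)
      ... | s , refl with proj₂ (proj₂ (proj₂ (choose-left ni))) (⟶-v a) | corr⇒rep (proj₂ tl-down)
      ... | b , far | e = subst (λ z → A z v) (sym e) (⟶-v⁻ b) , farther far
        where
        farther : s ≡ tl ⊎ tl Ψ.⟶ s → RΨ.rep s ≡ zl ⊎ A zl (RΨ.rep s)
        farther (inj₁ refl) = inj₁ (sym e)
        farther (inj₂ (Ψ.arrow c)) = inj₂ (subst (λ z → A z (RΨ.rep s)) (sym e) (to (RΨ.arrow tl s) c))

      rightmost : ∀ {w} → Rep w → A v w → A v zr × (w ≡ zr ⊎ A w zr)
      rightmost {w} r a with RΨ.complete w (inj₂ r)
      ... | s , refl with proj₂ (proj₂ (proj₂ (choose-right ni))) (v-⟶ a) | corr⇒rep (proj₂ tr-down)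
      ... | b , far | e = subst (A v) (sym e) (v-⟶⁻ b) , farther far
        where
        farther : s ≡ tr ⊎ s Ψ.⟶ tr → RΨ.rep s ≡ zr ⊎ A (RΨ.rep s) zr
        farther (inj₁ refl) = inj₁ (sym e)
        farther (inj₂ (Ψ.arrow c)) = inj₂ (subst (A (RΨ.rep s)) (sym e) (to (RΨ.arrow s tr) c))

      -- `x ≢ zr` serves the case where only `x` is adjacent to `v`, and `y ≢ zl` the case where
      -- only `y` is. If `v` does not tell them apart, `twin-reps` already identifies them.
      no-dominated : ∀ {x y} → Rep x → Rep y → x ≢ zr → y ≢ zl → ¬ Dominates x y
      no-dominated {x} {y} rx ry x≢zr y≢zl dom@(xy , _) with Adj⁺? x v | Adj⁺? y v
      ... | yes p | yes q = A⇒≢ xy (twin-reps rx ry (dominates⇒twin dom) (λ _ → q) (λ _ → p))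
      ... | no ¬p | no ¬q = A⇒≢ xy (twin-reps rx ry (dominates⇒twin dom) (⊥-elim ∘ ¬p) (⊥-elim ∘ ¬q))
      no-dominated {x} {y} rx ry x≢zr y≢zl dom@(xy , _) | yes p | no ¬q with Adj⁺⇒A p
      ... | inj₁ e = proj₁ rx e
      -- If `x → v`, then this arrow passes over `y` or `x → y` passes over `v`; both make `y`
      -- adjacent to `v`. What remains is `v → x`.
      ... | inj₂ (inj₁ xv) with spans-or (A⇒≢ xy) (proj₁ ry) (A⇒≢ xv)
      ... | inj₁ s = ¬q (A⇒Adj⁺ (inj₂ (inj₁ (proj₂ (proj₁ s xv)))))
      ... | inj₂ s = ¬q (A⇒Adj⁺ (inj₂ (inj₂ (proj₂ (proj₁ s xy)))))
      no-dominated {x} {y} rx ry x≢zr y≢zl dom@(xy , _) | yes p | no ¬q | inj₂ (inj₂ vx) with rightmost rx vx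
      ... | _ , inj₁ e = x≢zr e
      -- If `y` comes before `zr`, the arrow `v → zr` passes over `y`. Otherwise `zr` lies between
      -- `x` and `y`.
      ... | vz , inj₂ xz with spans-or (A⇒≢ xy) (λ { refl → ¬q (A⇒Adj⁺ (inj₂ (inj₂ vz))) }) x≢zr
      ... | inj₁ s = ¬q (A⇒Adj⁺ (inj₂ (inj₂ (enter vx xy (proj₂ (proj₁ s xz)) xz vz))))
      ... | inj₂ s = x≢zr (twin-reps rx (RΦ.sound br) (dominates⇒twin (dominates-between dom xz (proj₂ (proj₁ s xy))))
                       (λ _ → A⇒Adj⁺ (inj₂ (inj₂ vz))) (λ _ → p))
      no-dominated {x} {y} rx ry x≢zr y≢zl dom@(xy , _) | no ¬p | yes q with Adj⁺⇒A q
      ... | inj₁ e = proj₁ ry e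
      ... | inj₂ (inj₂ vy) with spans-or (proj₁ rx) (A⇒≢ vy) (A⇒≢ xy)
      ... | inj₁ s = ¬p (A⇒Adj⁺ (inj₂ (inj₁ (proj₁ (proj₁ s xy)))))
      ... | inj₂ s = ¬p (A⇒Adj⁺ (inj₂ (inj₂ (proj₁ (proj₂ (proj₂ s) vy)))))
      no-dominated {x} {y} rx ry x≢zr y≢zl dom@(xy , _) | no ¬p | yes q | inj₂ (inj₁ yv) with leftmost ry yv
      ... | _ , inj₁ e = y≢zl e
      -- If `zl` lies behind `x`, the arrow `zl → v` passes over `x`. Otherwise `zl` lies between
      -- `x` and `y`.
      ... | zv , inj₂ zy with spans-or {x} {zl} {y} (λ { refl → ¬p (A⇒Adj⁺ (inj₂ (inj₁ zv))) }) (y≢zl ∘ sym) (A⇒≢ xy)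
      ... | inj₂ s = ¬p (A⇒Adj⁺ (inj₂ (inj₁ (leave (proj₁ (proj₂ (proj₂ s) zy)) xy zy yv zv))))
      -- Domination makes `zl` a twin of `x` on the representatives; `x` is one of `y`, though not
      -- with respect to `v`, where `zl` and `y` agree.
      ... | inj₁ s = y≢zl (sym (twin-reps (RΦ.sound bl) ry
                       (λ w r → proj₁ (xy-twin w r) ∘ proj₂ (xz-twin w r) , proj₁ (xz-twin w r) ∘ proj₂ (xy-twin w r))
                       (λ _ → q) (λ _ → A⇒Adj⁺ (inj₂ (inj₁ zv)))))
        where
        xy-twin = dominates⇒twin dom
        xz-twin = dominates⇒twin (dominates-between dom (proj₁ (proj₁ s xy)) zy)

      vertexwise : ∀ {s t} → Φ.Dominated s t → Dominates (RΦ.rep s) (RΦ.rep t)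
      vertexwise {s} {t} (Φ.arrow st , into , out) = to (RΦ.arrow s t) st , into′ , out′
        where
        into′ : ∀ w → Rep w → A w (RΦ.rep s) → A w (RΦ.rep t)
        into′ w r a with RΦ.complete w r
        ... | u , refl = to (RΦ.arrow u t) (Φ._⟶_.holds (into u (Φ.arrow (from (RΦ.arrow u s) a))))
        out′ : ∀ w → Rep w → A (RΦ.rep t) w → A (RΦ.rep s) w
        out′ w r a with RΦ.complete w r
        ... | u , refl = to (RΦ.arrow s u) (Φ._⟶_.holds (out u (Φ.arrow (from (RΦ.arrow t u) a))))

      distinguishable : ∀ s t → s ≢ t → s ≢ bl → s ≢ br → t ≢ bl → t ≢ br → ¬ Indist (rw Φ) s t
      distinguishable s t s≢t s≢bl s≢br t≢bl t≢br ind with Φ.indist⇒dominated s≢t ind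
      ... | inj₁ d = no-dominated (RΦ.sound s) (RΦ.sound t) (s≢br ∘ RΦ.rep-inj) (t≢bl ∘ RΦ.rep-inj) (vertexwise d)
      ... | inj₂ d = no-dominated (RΦ.sound t) (RΦ.sound s) (t≢br ∘ RΦ.rep-inj) (s≢bl ∘ RΦ.rep-inj) (vertexwise d)

      receptive : VReceptive H v Φ
      receptive = bl , br , (Ψ , reception) , neighbourhood , distinguishable

theorem4 : ∀ {N : ℕ} (H : Graph N) (v : Fin N) → NonIsolated H v →
    (PCA H ⇔ Σ (RoundRep N) (λ Φ → RepresentsMinus Φ H v × VReceptive H v Φ)) ×
    (∀ (Φ : RoundRep N) → RepresentsMinus Φ H v →
    ∀ bl br → WitnessesReceptive H v Φ bl br →
    ∀ (Ψ : RoundRep N) → IsReception Φ v bl br Ψ → RepresentsG Ψ H)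
theorem4 {N} H v ni = mk⇔ receptive-representation pca , second
  where
  second : ∀ Φ → RepresentsMinus Φ H v → ∀ bl br → WitnessesReceptive H v Φ bl br →
           ∀ Ψ → IsReception Φ v bl br Ψ → RepresentsG Ψ H
  second Φ minus bl br (_ , nbhd , _) Ψ rec = Reception.represents Φ Ψ v bl br rec H minus nbhd
  pca : Σ (RoundRep N) (λ Φ → RepresentsMinus Φ H v × VReceptive H v Φ) → PCA H
  pca (Φ , minus , bl , br , wit@((Ψ , rec) , _)) with second Φ minus bl br wit Ψ rec
  ... | covers , adjacency = N , Ψ , (λ x → x) , (λ e → e) , (λ y → mk⇔ (λ _ → y , refl) (λ _ → covers y))
                           , λ x y → mk⇔ (from (adjacency x y)) (to (adjacency x y))
  receptive-representation : PCA H → Σ (RoundRep N) (λ Φ → RepresentsMinus Φ H v × VReceptive H v Φ)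
  receptive-representation p = BΦ.rep , C.Φ-represents , C.receptive ni
    where
    open Forward H v (orientation H p)
    -- Both representations come from the same orientation and the same classes; only the set of
    -- kept vertices differs, by `v`.
    module BΨ = Build Rep⁺? (λ r → r)
    module BΦ = Build Rep? inj₂
    module C = Compare BΨ.rep BΦ.rep BΨ.realises BΦ.realises
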